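{- For all integers $m\geq 1$ and $n\geq 0$, \[ \overline{M2}(m-1,n)\geq \overline{M2}(m,n). \]
   Context: Notation: $(a;q)_\infty=\prod_{j\geq 0}(1-aq^j)$. An overpartition of $n$ is a partition of $n$ in which the first occurrence of each part size may be overlined. The crank of an ordinary partition is its largest part if it has no parts equal to $1$, and otherwise the number of parts larger than the number of ones minus the number of ones. The second residual crank of an overpartition is the crank of the ordinary partition obtained by taking all even non-overlined parts and dividing each by two. $\overline{M2}(m,n)$ is the number of overpartitions of $n$ with second residual crank $m$, with the modification that an overpartition for which this halved partition is the single part $1$ contributes $-1$ to $\overline{M2}(0,n)$ and $+1$ to each of $\overline{M2}(-1,n)$ and $\overline{M2}(1,n)$. Equivalently, \[ \sum_{m=-\infty}^{\infty}\sum_{n\geq 0}\overline{M2}(m,n)z^mq^n=\frac{(-q;q)_\infty(q;q)_\infty}{(q;q^2)_\infty(zq;q)_\infty(q/z;q)_\infty}. \] -}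

module Defs where

open import Data.Nat as ℕ using (ℕ; zero; suc; _*_; _∸_; _≡ᵇ_; _<ᵇ_; _⊔_; _%_; ⌊_/2⌋)
open import Data.Integer as ℤ using (ℤ; +_; -_; _-_; _+_)
open import Data.Bool using (Bool; true; false; if_then_else_; not; _∨_; _∧_)
open import Data.List using (List; []; _∷_; [_]; _++_; map; concatMap; cartesianProduct; upTo; replicate; filterᵇ; length; foldr)
open import Data.Product using (_×_; _,_)
open import Relation.Nullary using (does)

-- Overpartitions in multiplicity form.
-- An overpartition is encoded as a list whose i-th entry (0-based)
-- is (mult, ov) for the part size i+1: mult = number of occurrences of
-- the part i+1, ov = whether its first occurrence is overlined
-- (only allowed when mult ≥ 1). Trailing entries are (0 , false).

OPData : Set
OPData = List (ℕ × Bool)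

weight : ℕ → OPData → ℕ
weight k []              = 0
weight k ((m , b) ∷ xs)  = k * m ℕ.+ weight (suc k) xs

wellFormed : OPData → Bool
wellFormed []             = true
wellFormed ((m , b) ∷ xs) = (not b ∨ (0 <ᵇ m)) ∧ wellFormed xs

codes : ℕ → ℕ → List OPData
codes n zero    = [ [] ]
codes n (suc k) =
  concatMap (λ x → map (x ∷_) (codes n k))
            (cartesianProduct (upTo (suc n)) (true ∷ false ∷ []))

overpartitions : ℕ → List OPData
overpartitions n = filterᵇ (λ xs → (weight 1 xs ≡ᵇ n) ∧ wellFormed xs) (codes n n)

-- the (multiset of) parts obtained from the even non-overlined parts,
-- each divided by two; head of xs describes part size k
halved : ℕ → OPData → List ℕ
halved k []             = []
halved k ((m , b) ∷ xs) =
  (if k % 2 ≡ᵇ 0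
     then replicate (m ∸ (if b then 1 else 0)) ⌊ k /2⌋
     else [])
  ++ halved (suc k) xs

countᵇ : (ℕ → Bool) → List ℕ → ℕ
countᵇ p xs = length (filterᵇ p xs)

crank : List ℕ → ℤ
crank ps =
  let ω = countᵇ (_≡ᵇ 1) ps in
  if ω ≡ᵇ 0
    then + foldr _⊔_ 0 ps
    else + countᵇ (ω <ᵇ_) ps - + ω

secondResidualCrank : OPData → ℤ
secondResidualCrank xs = crank (halved 1 xs)

halvedIsOne : OPData → Bool
halvedIsOne xs with halved 1 xs
... | 1 ∷ [] = true
... | _      = false

special : ℤ → ℤ
special m =
  if does (m ℤ.≟ + 0) then - + 1
  else if does (m ℤ.≟ + 1) ∨ does (m ℤ.≟ - + 1) then + 1
  else + 0

contribution : ℤ → OPData → ℤ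
contribution m xs =
  if halvedIsOne xs then special m
  else (if does (secondResidualCrank xs ℤ.≟ m) then + 1 else + 0)

M2 : ℤ → ℕ → ℤ
M2 m n = foldr (λ xs acc → contribution m xs + acc) (+ 0) (overpartitions n)

{-# OPTIONS --safe #-}

-- With Q = q² and χᵢ = z⁻ⁱ + ... + zⁱ, the generating function of the M2(m,n) is
--   ∏ (1 + q²ʲ⁻¹)  ·  ∏ (1 − Qʲ)/(1 − q²ʲ⁻¹)  ·  ∏ (1 + Qʲ)/((1 − zQʲ)(1 − Qʲ/z)).
-- By Gauss's identity the second product is Σ q^(k(k+1)/2), and each factor of the
-- third is Σᵢ Qʲⁱ χᵢ.  Since χₖ χₗ is a sum of χ's, the whole product is a nonnegative
-- combination of the qᵃ χₖ, whose coefficients decrease away from z⁰.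
--
-- The crank product comes from splitting partitions by their number of ones and
-- summing with the q-binomial theorem.  All identities are taken modulo q^(n+1), in a
-- commutative ring with elements z and y = q/z, y nilpotent; there q = zy and
-- Q/z = qy, so no negative powers of z occur.
module Submission where

open import Defs
open import Algebra.Bundles using (CommutativeRing)
import Algebra.Solver.Ring
open import Algebra.Solver.Ring.AlmostCommutativeRing using (fromCommutativeRing; _-Raw-AlmostCommutative⟶_)
open import Data.Bool.Base using (Bool; true; false; if_then_else_; _∧_)
open import Data.Integer.Base as ℤ using (ℤ; +_; -[1+_])
import Data.Integer.Properties as ℤ
open import Data.List.Base using (List; []; _∷_; _++_; map; concatMap; cartesianProduct; applyUpTo; upTo; replicate; filterᵇ; foldr)
open import Data.Maybe.Base using (Maybe; just; nothing)
open import Data.Nat.Base as ℕ using (ℕ; zero; suc; z≤n; s≤s)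
import Data.Nat.Properties as ℕ
open import Data.Nat.Solver using (module +-*-Solver)
open import Data.Product.Base using (_×_; _,_)
open import Function.Base using (_∘_; id)
open import Level using (Level; _⊔_)
open import Relation.Binary.PropositionalEquality as ≡ using (_≡_)
open import Relation.Nullary using (Dec; does; yes; no; contradiction)
open +-*-Solver using () renaming (solve to ℕ-solve; _:+_ to _⊕_; _:=_ to _⊜_; con to ℕcon)

-- The obstacle is the numerator ∏ (1 - Qʲ) of the crank product: its signs hide any positivity, and
-- it becomes harmless only when divided by the ∏ (1 - q²ʲ⁻¹) that the odd non-overlined parts
-- provide. The modified values for the single part 1 exceed its crank term z⁻¹Q by zQ - Q. Exactly
-- this excess completes the partitions without ones to (1 - Q)/∏ (1 - zQʲ), the factor shared by
-- the terms with ones; the sum over the number of ones is then one q-binomial series. In the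
-- variables y and z, the monomial qⁿzᵏ is yⁿzⁿ⁺ᵏ, so for k ≥ 0 its coefficient is an ordinary
-- bivariate coefficient. Limits become divisibility by powers of y: whatever has order above n is
-- zero, so products stop after n factors and 1/(1 - x) is a finite sum. Codes are summed without
-- any condition on their weight, which is selected only when the coefficient is read off.

module IntegerCoefficients {c ℓ : Level} (R : CommutativeRing c ℓ) where

  open CommutativeRing R hiding (zero)
  open import Algebra.Properties.Ring ring using (-‿distribˡ-*; -‿distribʳ-*; -0#≈0#; -‿involutive)
  open import Algebra.Properties.AbelianGroup +-abelianGroup using (⁻¹-∙-comm)
  open import Algebra.Properties.Semiring.Mult semiring using (×-homo-+; ×1-homo-*) renaming (_×_ to _⋆_)
  open import Relation.Binary.Reasoning.Setoid setoid

  -- The ring solver has to decide equality of coefficients, which an abstract ring cannot do; the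
  -- coefficients are therefore integers, mapped into the ring.
  fromℤ : ℤ → Carrier
  fromℤ (+ n)    = n ⋆ 1#
  fromℤ -[1+ n ] = - (suc n ⋆ 1#)

  fromℤ-neg : ∀ i → fromℤ (ℤ.- i) ≈ - fromℤ i
  fromℤ-neg (+ zero)  = sym -0#≈0#
  fromℤ-neg (+ suc n) = refl
  fromℤ-neg -[1+ n ]  = sym (-‿involutive _)

  fromℤ-⊖ : ∀ m n → fromℤ (m ℤ.⊖ n) ≈ m ⋆ 1# - n ⋆ 1#
  fromℤ-⊖ m zero = sym (trans (+-congˡ -0#≈0#) (+-identityʳ _))
  fromℤ-⊖ zero (suc n) = sym (+-identityˡ _)
  fromℤ-⊖ (suc m) (suc n) = begin
    fromℤ (suc m ℤ.⊖ suc n)              ≡⟨ ≡.cong fromℤ (ℤ.[1+m]⊖[1+n]≡m⊖n m n) ⟩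
    fromℤ (m ℤ.⊖ n)                      ≈⟨ fromℤ-⊖ m n ⟩
    m ⋆ 1# - n ⋆ 1#                      ≈⟨ +-identityˡ _ ⟨
    0# + (m ⋆ 1# - n ⋆ 1#)               ≈⟨ +-congʳ (-‿inverseʳ 1#) ⟨
    (1# - 1#) + (m ⋆ 1# - n ⋆ 1#)        ≈⟨ +-assoc _ _ _ ⟩
    1# + (- 1# + (m ⋆ 1# - n ⋆ 1#))      ≈⟨ +-congˡ (+-assoc _ _ _) ⟨
    1# + ((- 1# + m ⋆ 1#) - n ⋆ 1#)      ≈⟨ +-congˡ (+-congʳ (+-comm _ _)) ⟩
    1# + ((m ⋆ 1# - 1#) - n ⋆ 1#)        ≈⟨ +-congˡ (+-assoc _ _ _) ⟩
    1# + (m ⋆ 1# + (- 1# - n ⋆ 1#))      ≈⟨ +-assoc _ _ _ ⟨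
    (1# + m ⋆ 1#) + (- 1# - n ⋆ 1#)      ≈⟨ +-congˡ (⁻¹-∙-comm _ _) ⟩
    suc m ⋆ 1# - suc n ⋆ 1#              ∎

  fromℤ-+ : ∀ i j → fromℤ (i ℤ.+ j) ≈ fromℤ i + fromℤ j
  fromℤ-+ (+ m)    (+ n)    = ×-homo-+ 1# m n
  fromℤ-+ (+ m)    -[1+ n ] = fromℤ-⊖ m (suc n)
  fromℤ-+ -[1+ m ] (+ n)    = trans (fromℤ-⊖ n (suc m)) (+-comm _ _)
  fromℤ-+ -[1+ m ] -[1+ n ] = begin
    - (suc (suc (m ℕ.+ n)) ⋆ 1#)  ≈⟨ -‿cong (+-congˡ (×-homo-+ 1# (suc m) n)) ⟩
    - (1# + (suc m ⋆ 1# + n ⋆ 1#)) ≈⟨ -‿cong (+-assoc _ _ _) ⟨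
    - ((1# + suc m ⋆ 1#) + n ⋆ 1#) ≈⟨ -‿cong (+-congʳ (+-comm _ _)) ⟩
    - ((suc m ⋆ 1# + 1#) + n ⋆ 1#) ≈⟨ -‿cong (+-assoc _ _ _) ⟩
    - (suc m ⋆ 1# + suc n ⋆ 1#)    ≈⟨ ⁻¹-∙-comm _ _ ⟨
    - (suc m ⋆ 1#) - suc n ⋆ 1#    ∎

  fromℤ-*⁺ : ∀ m j → fromℤ (+ m ℤ.* j) ≈ m ⋆ 1# * fromℤ j
  fromℤ-*⁺ m (+ n) = trans (reflexive (≡.cong fromℤ (≡.sym (ℤ.pos-* m n)))) (×1-homo-* m n)
  fromℤ-*⁺ m -[1+ n ] = begin
    fromℤ (+ m ℤ.* (ℤ.- + suc n))  ≡⟨ ≡.cong fromℤ (ℤ.neg-distribʳ-* (+ m) (+ suc n)) ⟨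
    fromℤ (ℤ.- (+ m ℤ.* + suc n))  ≈⟨ fromℤ-neg (+ m ℤ.* + suc n) ⟩
    - fromℤ (+ m ℤ.* + suc n)      ≈⟨ -‿cong (fromℤ-*⁺ m (+ suc n)) ⟩
    - (m ⋆ 1# * suc n ⋆ 1#)        ≈⟨ -‿distribʳ-* _ _ ⟩
    m ⋆ 1# * - (suc n ⋆ 1#)        ∎

  fromℤ-* : ∀ i j → fromℤ (i ℤ.* j) ≈ fromℤ i * fromℤ j
  fromℤ-* (+ m) j = fromℤ-*⁺ m j
  fromℤ-* -[1+ m ] j = begin
    fromℤ (ℤ.- + suc m ℤ.* j)      ≡⟨ ≡.cong fromℤ (ℤ.neg-distribˡ-* (+ suc m) j) ⟨
    fromℤ (ℤ.- (+ suc m ℤ.* j))    ≈⟨ fromℤ-neg (+ suc m ℤ.* j) ⟩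
    - fromℤ (+ suc m ℤ.* j)        ≈⟨ -‿cong (fromℤ-*⁺ (suc m) j) ⟩
    - (suc m ⋆ 1# * fromℤ j)       ≈⟨ -‿distribˡ-* _ _ ⟩
    - (suc m ⋆ 1#) * fromℤ j       ∎

  -- A variant in which the coefficient 1 evaluates to 1# rather than to 1# + 0#,
  -- so that solver goals mention 1# literally.
  ⟦_⟧ℤ : ℤ → Carrier
  ⟦ + 1 ⟧ℤ = 1#
  ⟦ i   ⟧ℤ = fromℤ i

  ⟦⟧ℤ≈fromℤ : ∀ i → ⟦ i ⟧ℤ ≈ fromℤ i
  ⟦⟧ℤ≈fromℤ (+ 0)           = refl
  ⟦⟧ℤ≈fromℤ (+ 1)           = sym (+-identityʳ 1#)
  ⟦⟧ℤ≈fromℤ (+ suc (suc n)) = refl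
  ⟦⟧ℤ≈fromℤ -[1+ n ]        = refl

  ⟦⟧ℤ-morphism : ℤ.+-*-rawRing -Raw-AlmostCommutative⟶ fromCommutativeRing R
  ⟦⟧ℤ-morphism = record
    { ⟦_⟧    = ⟦_⟧ℤ
    ; +-homo = λ i j → trans (⟦⟧ℤ≈fromℤ (i ℤ.+ j)) (trans (fromℤ-+ i j) (sym (+-cong (⟦⟧ℤ≈fromℤ i) (⟦⟧ℤ≈fromℤ j))))
    ; *-homo = λ i j → trans (⟦⟧ℤ≈fromℤ (i ℤ.* j)) (trans (fromℤ-* i j) (sym (*-cong (⟦⟧ℤ≈fromℤ i) (⟦⟧ℤ≈fromℤ j))))
    ; -‿homo = λ i → trans (⟦⟧ℤ≈fromℤ (ℤ.- i)) (trans (fromℤ-neg i) (sym (-‿cong (⟦⟧ℤ≈fromℤ i))))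
    ; 0-homo = refl
    ; 1-homo = refl
    }

  ⟦⟧ℤ-≟ : ∀ i j → Maybe (⟦ i ⟧ℤ ≈ ⟦ j ⟧ℤ)
  ⟦⟧ℤ-≟ i j with i ℤ.≟ j
  ... | yes i≡j = just (reflexive (≡.cong ⟦_⟧ℤ i≡j))
  ... | no _    = nothing

  open Algebra.Solver.Ring ℤ.+-*-rawRing (fromCommutativeRing R) ⟦⟧ℤ-morphism ⟦⟧ℤ-≟ public
    using (solve; _:=_; _:+_; _:*_; _:-_; con)

-- Truncated power series over a commutative ring.

module PowerSeries {c ℓ : Level} (A : CommutativeRing c ℓ) (N : ℕ) where

  open CommutativeRing A hiding (zero)
  open import Relation.Binary.Reasoning.Setoid setoid
  open IntegerCoefficients A using (solve; _:=_; _:+_; _:*_)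

  Series : Set c
  Series = ℕ → Carrier

  infix  4 _≈ₛ_
  infixl 6 _+ₛ_
  infixl 7 _*ₛ_

  -- Series are compared up to degree N only, so X ^ suc N is zero.
  _≈ₛ_ : Series → Series → Set ℓ
  f ≈ₛ g = ∀ i → i ℕ.≤ N → f i ≈ g i

  -- The product is the Cauchy product, read from the decomposition f = f 0 + X · (f ∘ suc) of the
  -- left factor.
  _+ₛ_ _*ₛ_ : Series → Series → Series
  (f +ₛ g) i = f i + g i
  (f *ₛ g) zero    = f 0 * g 0
  (f *ₛ g) (suc i) = f 0 * g (suc i) + (f ∘ suc *ₛ g) i

  -ₛ_ : Series → Series
  (-ₛ f) i = - f i

  constant : Carrier → Series
  constant a zero    = a
  constant a (suc _) = 0#

  0ₛ 1ₛ X : Series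
  0ₛ _ = 0#
  1ₛ = constant 1#
  X zero    = 0#
  X (suc i) = 1ₛ i

  -- Coefficient `i` of a product involves only coefficients up to `i`; this makes equality up to
  -- degree `N` a congruence.
  *ₛ-cong : ∀ i {f f′ g g′} → (∀ j → j ℕ.≤ i → f j ≈ f′ j) → (∀ j → j ℕ.≤ i → g j ≈ g′ j) →
    (f *ₛ g) i ≈ (f′ *ₛ g′) i
  *ₛ-cong zero    p q = *-cong (p 0 z≤n) (q 0 z≤n)
  *ₛ-cong (suc i) p q = +-cong (*-cong (p 0 z≤n) (q (suc i) ℕ.≤-refl))
    (*ₛ-cong i (λ j j≤i → p (suc j) (s≤s j≤i)) (λ j j≤i → q j (ℕ.m≤n⇒m≤1+n j≤i)))

  *ₛ-distribʳ : ∀ h f g i → ((f +ₛ g) *ₛ h) i ≈ (f *ₛ h) i + (g *ₛ h) i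
  *ₛ-distribʳ h f g zero    = distribʳ _ _ _
  *ₛ-distribʳ h f g (suc i) = begin
    (f 0 + g 0) * h (suc i) + ((f ∘ suc +ₛ g ∘ suc) *ₛ h) i
      ≈⟨ +-congˡ (*ₛ-distribʳ h (f ∘ suc) (g ∘ suc) i) ⟩
    (f 0 + g 0) * h (suc i) + ((f ∘ suc *ₛ h) i + (g ∘ suc *ₛ h) i)
      ≈⟨ solve 5 (λ a b x u v → (a :+ b) :* x :+ (u :+ v) := (a :* x :+ u) :+ (b :* x :+ v)) refl _ _ _ _ _ ⟩
    (f *ₛ h) (suc i) + (g *ₛ h) (suc i) ∎

  *ₛ-scale : ∀ a f g i → ((λ j → a * f j) *ₛ g) i ≈ a * (f *ₛ g) i
  *ₛ-scale a f g zero    = *-assoc _ _ _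
  *ₛ-scale a f g (suc i) = begin
    a * f 0 * g (suc i) + ((λ j → a * f (suc j)) *ₛ g) i ≈⟨ +-congˡ (*ₛ-scale a (f ∘ suc) g i) ⟩
    a * f 0 * g (suc i) + a * (f ∘ suc *ₛ g) i
      ≈⟨ solve 4 (λ a x y u → a :* x :* y :+ a :* u := a :* (x :* y :+ u)) refl _ _ _ _ ⟩
    a * (f *ₛ g) (suc i) ∎

  *ₛ-assoc : ∀ f g h i → ((f *ₛ g) *ₛ h) i ≈ (f *ₛ (g *ₛ h)) i
  *ₛ-assoc f g h zero    = *-assoc _ _ _
  *ₛ-assoc f g h (suc i) = begin
    f 0 * g 0 * h (suc i) + (((λ j → f 0 * g (suc j)) +ₛ (f ∘ suc *ₛ g)) *ₛ h) i
      ≈⟨ +-congˡ (*ₛ-distribʳ h (λ j → f 0 * g (suc j)) (f ∘ suc *ₛ g) i) ⟩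
    f 0 * g 0 * h (suc i) + (((λ j → f 0 * g (suc j)) *ₛ h) i + ((f ∘ suc *ₛ g) *ₛ h) i)
      ≈⟨ +-congˡ (+-cong (*ₛ-scale (f 0) (g ∘ suc) h i) (*ₛ-assoc (f ∘ suc) g h i)) ⟩
    f 0 * g 0 * h (suc i) + (f 0 * (g ∘ suc *ₛ h) i + (f ∘ suc *ₛ (g *ₛ h)) i)
      ≈⟨ solve 5 (λ a b x u v → a :* b :* x :+ (a :* u :+ v) := a :* (b :* x :+ u) :+ v) refl _ _ _ _ _ ⟩
    (f *ₛ (g *ₛ h)) (suc i) ∎

  -- The mirror image of the defining recursion, splitting off the constant term of the right
  -- factor; commutativity follows by matching the two.
  *ₛ-sucʳ : ∀ f g i → (f *ₛ g) (suc i) ≈ (f *ₛ g ∘ suc) i + f (suc i) * g 0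
  *ₛ-sucʳ f g zero    = refl
  *ₛ-sucʳ f g (suc i) = trans (+-congˡ (*ₛ-sucʳ (f ∘ suc) g i)) (sym (+-assoc _ _ _))

  *ₛ-comm : ∀ f g i → (f *ₛ g) i ≈ (g *ₛ f) i
  *ₛ-comm f g zero    = *-comm _ _
  *ₛ-comm f g (suc i) = begin
    f 0 * g (suc i) + (f ∘ suc *ₛ g) i  ≈⟨ +-cong (*-comm _ _) (*ₛ-comm (f ∘ suc) g i) ⟩
    g (suc i) * f 0 + (g *ₛ f ∘ suc) i  ≈⟨ +-comm _ _ ⟩
    (g *ₛ f ∘ suc) i + g (suc i) * f 0  ≈⟨ *ₛ-sucʳ g f i ⟨
    (g *ₛ f) (suc i)                    ∎

  0ₛ*ₛ : ∀ f i → (0ₛ *ₛ f) i ≈ 0#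
  0ₛ*ₛ f zero    = zeroˡ _
  0ₛ*ₛ f (suc i) = trans (+-cong (zeroˡ _) (0ₛ*ₛ f i)) (+-identityˡ _)

  constant*ₛ : ∀ a f i → (constant a *ₛ f) i ≈ a * f i
  constant*ₛ a f zero    = refl
  constant*ₛ a f (suc i) = trans (+-congˡ (0ₛ*ₛ f i)) (+-identityʳ _)

  1ₛ*ₛ : ∀ f i → (1ₛ *ₛ f) i ≈ f i
  1ₛ*ₛ f i = trans (constant*ₛ 1# f i) (*-identityˡ _)

  seriesRing : CommutativeRing c ℓ
  seriesRing = record
    { Carrier = Series ; _≈_ = _≈ₛ_ ; _+_ = _+ₛ_ ; _*_ = _*ₛ_ ; -_ = -ₛ_ ; 0# = 0ₛ ; 1# = 1ₛ
    ; isCommutativeRing = record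
      { isRing = record
        { +-isAbelianGroup = record
          { isGroup = record
            { isMonoid = record
              { isSemigroup = record
                { isMagma = record
                  { isEquivalence = record
                    { refl  = λ _ _ → refl
                    ; sym   = λ p i i≤N → sym (p i i≤N)
                    ; trans = λ p q i i≤N → trans (p i i≤N) (q i i≤N)
                    }
                  ; ∙-cong = λ p q i i≤N → +-cong (p i i≤N) (q i i≤N)
                  }
                ; assoc = λ _ _ _ _ _ → +-assoc _ _ _
                }
              ; identity = (λ _ _ _ → +-identityˡ _) , (λ _ _ _ → +-identityʳ _)
              }
            ; inverse = (λ _ _ _ → -‿inverseˡ _) , (λ _ _ _ → -‿inverseʳ _)
            ; ⁻¹-cong = λ p i i≤N → -‿cong (p i i≤N)
            }
          ; comm = λ _ _ _ _ → +-comm _ _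
          }
        ; *-cong = λ p q i i≤N → *ₛ-cong i (λ j j≤i → p j (ℕ.≤-trans j≤i i≤N)) (λ j j≤i → q j (ℕ.≤-trans j≤i i≤N))
        ; *-assoc = λ f g h i _ → *ₛ-assoc f g h i
        ; *-identity = (λ f i _ → 1ₛ*ₛ f i) , (λ f i _ → trans (*ₛ-comm f 1ₛ i) (1ₛ*ₛ f i))
        ; distrib = (λ f g h i _ → trans (*ₛ-comm f (g +ₛ h) i) (trans (*ₛ-distribʳ f g h i)
                      (+-cong (*ₛ-comm g f i) (*ₛ-comm h f i))))
                  , (λ f g h i _ → *ₛ-distribʳ f g h i)
        }
      ; *-comm = λ f g i _ → *ₛ-comm f g i
      }
    }

  open import Algebra.Properties.Semiring.Exp (CommutativeRing.semiring seriesRing) public using (_^_)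
  open import Algebra.Properties.Semiring.Exp semiring using () renaming (_^_ to _^ᴬ_)

  X*ₛ-zero : ∀ f → (X *ₛ f) 0 ≈ 0#
  X*ₛ-zero f = zeroˡ _

  X*ₛ-suc : ∀ f i → (X *ₛ f) (suc i) ≈ f i
  X*ₛ-suc f i = trans (+-cong (zeroˡ _) (1ₛ*ₛ f i)) (+-identityˡ _)

  X^*ₛconstant : ∀ k a i → (X ^ k *ₛ constant a) i ≈ (if k ℕ.≡ᵇ i then a else 0#)
  X^*ₛconstant zero    a zero    = *-identityˡ _
  X^*ₛconstant zero    a (suc i) = 1ₛ*ₛ (constant a) (suc i)
  X^*ₛconstant (suc k) a zero    = trans (*ₛ-assoc X (X ^ k) (constant a) 0) (X*ₛ-zero (X ^ k *ₛ constant a))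
  X^*ₛconstant (suc k) a (suc i) = begin
    (X *ₛ X ^ k *ₛ constant a) (suc i)   ≈⟨ *ₛ-assoc X (X ^ k) (constant a) (suc i) ⟩
    (X *ₛ (X ^ k *ₛ constant a)) (suc i) ≈⟨ X*ₛ-suc (X ^ k *ₛ constant a) i ⟩
    (X ^ k *ₛ constant a) i              ≈⟨ X^*ₛconstant k a i ⟩
    (if k ℕ.≡ᵇ i then a else 0#)         ∎

  X^-coefficient : ∀ k i → (X ^ k) i ≈ (if k ℕ.≡ᵇ i then 1# else 0#)
  X^-coefficient k i = trans (sym (trans (*ₛ-comm (X ^ k) 1ₛ i) (1ₛ*ₛ (X ^ k) i))) (X^*ₛconstant k 1# i)

  X^-nilpotent : X ^ suc N ≈ₛ 0ₛ
  X^-nilpotent i i≤N = trans (X^-coefficient (suc N) i) (vanish (suc N) i (s≤s i≤N))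
    where
    vanish : ∀ k j → j ℕ.< k → (if k ℕ.≡ᵇ j then 1# else 0#) ≈ 0#
    vanish (suc k) zero    _         = refl
    vanish (suc k) (suc j) (s≤s j<k) = vanish k j j<k

  constant-^ : ∀ a k → constant a ^ k ≈ₛ constant (a ^ᴬ k)
  constant-^ a zero    i _   = refl
  constant-^ a (suc k) i i≤N = begin
    (constant a *ₛ constant a ^ k) i  ≈⟨ constant*ₛ a (constant a ^ k) i ⟩
    a * (constant a ^ k) i            ≈⟨ *-congˡ (constant-^ a k i i≤N) ⟩
    a * constant (a ^ᴬ k) i           ≈⟨ scale i ⟩
    constant (a * a ^ᴬ k) i           ∎
    where
    scale : ∀ i → a * constant (a ^ᴬ k) i ≈ constant (a * a ^ᴬ k) i
    scale zero    = refl
    scale (suc i) = zeroʳ a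

-- Finite sums and products.

module FiniteSums {c ℓ : Level} (R : CommutativeRing c ℓ) where

  open CommutativeRing R hiding (zero)
  open import Relation.Binary.Reasoning.Setoid setoid

  Σ< Π< : ℕ → (ℕ → Carrier) → Carrier
  Σ< zero    f = 0#
  Σ< (suc k) f = Σ< k f + f k
  Π< zero    f = 1#
  Π< (suc k) f = Π< k f * f k

  Σ<-cong : ∀ k {f g} → (∀ i → i ℕ.< k → f i ≈ g i) → Σ< k f ≈ Σ< k g
  Σ<-cong zero    p = refl
  Σ<-cong (suc k) p = +-cong (Σ<-cong k (λ i i<k → p i (ℕ.m<n⇒m<1+n i<k))) (p k ℕ.≤-refl)

  Π<-cong : ∀ k {f g} → (∀ i → i ℕ.< k → f i ≈ g i) → Π< k f ≈ Π< k g
  Π<-cong zero    p = refl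
  Π<-cong (suc k) p = *-cong (Π<-cong k (λ i i<k → p i (ℕ.m<n⇒m<1+n i<k))) (p k ℕ.≤-refl)

  Σ<-front : ∀ k f → Σ< (suc k) f ≈ f 0 + Σ< k (f ∘ suc)
  Σ<-front zero    f = trans (+-identityˡ _) (sym (+-identityʳ _))
  Σ<-front (suc k) f = trans (+-congʳ (Σ<-front k f)) (+-assoc _ _ _)

  Π<-front : ∀ k f → Π< (suc k) f ≈ f 0 * Π< k (f ∘ suc)
  Π<-front zero    f = trans (*-identityˡ _) (sym (*-identityʳ _))
  Π<-front (suc k) f = trans (*-congʳ (Π<-front k f)) (*-assoc _ _ _)

  Σ<-zero : ∀ k {f} → (∀ i → i ℕ.< k → f i ≈ 0#) → Σ< k f ≈ 0#
  Σ<-zero zero    p = refl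
  Σ<-zero (suc k) p = trans (+-cong (Σ<-zero k (λ i i<k → p i (ℕ.m<n⇒m<1+n i<k))) (p k ℕ.≤-refl)) (+-identityˡ _)

  Π<-one : ∀ k {f} → (∀ i → i ℕ.< k → f i ≈ 1#) → Π< k f ≈ 1#
  Π<-one zero    p = refl
  Π<-one (suc k) p = trans (*-cong (Π<-one k (λ i i<k → p i (ℕ.m<n⇒m<1+n i<k))) (p k ℕ.≤-refl)) (*-identityˡ _)

  Σ<-*ˡ : ∀ k a f → Σ< k (λ i → a * f i) ≈ a * Σ< k f
  Σ<-*ˡ zero    a f = sym (zeroʳ a)
  Σ<-*ˡ (suc k) a f = trans (+-congʳ (Σ<-*ˡ k a f)) (sym (distribˡ _ _ _))

  Π<-* : ∀ k f g → Π< k (λ i → f i * g i) ≈ Π< k f * Π< k g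
  Π<-* zero    f g = sym (*-identityˡ _)
  Π<-* (suc k) f g = begin
    Π< k (λ i → f i * g i) * (f k * g k)  ≈⟨ *-congʳ (Π<-* k f g) ⟩
    (Π< k f * Π< k g) * (f k * g k)       ≈⟨ interchange _ _ _ _ ⟩
    (Π< k f * f k) * (Π< k g * g k)       ∎
    where open import Algebra.Properties.CommutativeSemigroup *-commutativeSemigroup using (interchange)

-- q-series identities in a ring with a nilpotent element.

module QSeries {c ℓ : Level} (R : CommutativeRing c ℓ) where

  open CommutativeRing R hiding (zero)
  open import Algebra.Properties.CommutativeSemiring.Exp commutativeSemiring
  open import Relation.Binary.Reasoning.Setoid setoid
  open IntegerCoefficients R using (solve; _:=_; _:+_; _:*_; _:-_; con)
  open FiniteSums R
  open import Algebra.Properties.CommutativeSemigroup *-commutativeSemigroup using (interchange; x∙yz≈y∙xz)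

  module Truncated (z y : Carrier) (n′ : ℕ) (y-nilpotent : y ^ suc (suc n′) ≈ 0#) where

    n : ℕ
    n = suc n′

    q Q v : Carrier
    q = z * y
    Q = q * q
    v = q * y

    -- Order at least `k` at y, with the cofactor as witness. Together with `Ord-vanish` it takes
    -- the place of every convergence argument.
    record Ord (k : ℕ) (x : Carrier) : Set (c ⊔ ℓ) where
      constructor ord
      field
        cofactor  : Carrier
        factorise : x ≈ y ^ k * cofactor

    Ord-≈ : ∀ {k x x′} → x ≈ x′ → Ord k x → Ord k x′
    Ord-≈ e (ord a p) = ord a (trans (sym e) p)

    Ord-* : ∀ {j k x x′} → Ord j x → Ord k x′ → Ord (j ℕ.+ k) (x * x′)
    Ord-* {j} {k} {x} {x′} (ord a p) (ord b r) = ord (a * b) (begin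
      x * x′                       ≈⟨ *-cong p r ⟩
      (y ^ j * a) * (y ^ k * b)    ≈⟨ interchange _ _ _ _ ⟩
      (y ^ j * y ^ k) * (a * b)    ≈⟨ *-congʳ (^-homo-* y j k) ⟨
      y ^ (j ℕ.+ k) * (a * b)      ∎)

    Ord-*ˡ : ∀ {k x} a → Ord k x → Ord k (a * x)
    Ord-*ˡ a (ord b p) = ord (a * b) (trans (*-congˡ p) (x∙yz≈y∙xz _ _ _))

    Ord-*ʳ : ∀ {k x} a → Ord k x → Ord k (x * a)
    Ord-*ʳ a o = Ord-≈ (*-comm _ _) (Ord-*ˡ a o)

    Ord-^ : ∀ {x} k → Ord 1 x → Ord k (x ^ k)
    Ord-^ zero    o = ord 1# (sym (*-identityˡ _))
    Ord-^ (suc k) o = Ord-* o (Ord-^ k o)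

    Ord-weaken : ∀ {j k x} → j ℕ.≤ k → Ord k x → Ord j x
    Ord-weaken {j} {k} {x} j≤k (ord a p) = ord (y ^ (k ℕ.∸ j) * a) (begin
      x                               ≈⟨ p ⟩
      y ^ k * a                       ≈⟨ *-congʳ (^-congʳ y (≡.sym (ℕ.m+[n∸m]≡n j≤k))) ⟩
      y ^ (j ℕ.+ (k ℕ.∸ j)) * a       ≈⟨ *-congʳ (^-homo-* y j (k ℕ.∸ j)) ⟩
      (y ^ j * y ^ (k ℕ.∸ j)) * a     ≈⟨ *-assoc _ _ _ ⟩
      y ^ j * (y ^ (k ℕ.∸ j) * a)     ∎)

    Ord-vanish : ∀ {k x} → n ℕ.< k → Ord k x → x ≈ 0#
    Ord-vanish n<k o with Ord-weaken n<k o
    ... | ord a p = trans p (trans (*-congʳ y-nilpotent) (zeroˡ a))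

    Ord-q : Ord 1 q
    Ord-q = Ord-*ˡ z (ord 1# (sym (trans (*-identityʳ _) (*-identityʳ _))))

    Ord-v : Ord 1 v
    Ord-v = Ord-*ʳ y Ord-q

    Ord-Q : Ord 1 Q
    Ord-Q = Ord-*ʳ q Ord-q

    Ord-Q^ : ∀ j → Ord 1 (Q ^ suc j)
    Ord-Q^ j = Ord-*ʳ (Q ^ j) Ord-Q

    Ord-0 : ∀ {k} → Ord k 0#
    Ord-0 = ord 0# (sym (zeroʳ _))

    -- Truncated geometric series: an inverse of 1# - x when x is divisible by y.
    geo : Carrier → Carrier
    geo x = Σ< (suc n) (x ^_)

    Σ<-geometric : ∀ x k → (1# - x) * Σ< k (x ^_) + x ^ k ≈ 1#
    Σ<-geometric x zero    = trans (+-congʳ (zeroʳ _)) (+-identityˡ _)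
    Σ<-geometric x (suc k) = trans
      (solve 3 (λ x s t → (con (+ 1) :- x) :* (s :+ t) :+ x :* t := (con (+ 1) :- x) :* s :+ t) refl x (Σ< k (x ^_)) (x ^ k))
      (Σ<-geometric x k)

    geo-inverse : ∀ {x} → Ord 1 x → (1# - x) * geo x ≈ 1#
    geo-inverse {x} o = begin
      (1# - x) * geo x                 ≈⟨ +-identityʳ _ ⟨
      (1# - x) * geo x + 0#            ≈⟨ +-congˡ (Ord-vanish ℕ.≤-refl (Ord-^ (suc n) o)) ⟨
      (1# - x) * geo x + x ^ suc n     ≈⟨ Σ<-geometric x (suc n) ⟩
      1#                               ∎

    geo-unfold : ∀ {x} → Ord 1 x → 1# + x * geo x ≈ geo x
    geo-unfold {x} o = begin
      1# + x * geo x                   ≈⟨ +-congʳ (geo-inverse o) ⟨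
      (1# - x) * geo x + x * geo x     ≈⟨ solve 2 (λ x g → (con (+ 1) :- x) :* g :+ x :* g := g) refl x (geo x) ⟩
      geo x                            ∎

    geo-cong : ∀ {x x′} → x ≈ x′ → geo x ≈ geo x′
    geo-cong e = Σ<-cong (suc n) (λ i _ → ^-congˡ i e)

    geo-divide : ∀ {x a b} → Ord 1 x → (1# - x) * a ≈ b → a ≈ b * geo x
    geo-divide {x} {a} {b} o p = begin
      a                        ≈⟨ *-identityˡ a ⟨
      1# * a                   ≈⟨ *-congʳ (geo-inverse o) ⟨
      (1# - x) * geo x * a     ≈⟨ solve 3 (λ u g a → u :* g :* a := u :* a :* g) refl (1# - x) (geo x) a ⟩
      (1# - x) * a * geo x     ≈⟨ *-congʳ p ⟩
      b * geo x                ∎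

    Π<-geo-inverse : ∀ k {f} → (∀ i → Ord 1 (f i)) → Π< k (λ i → 1# - f i) * Π< k (geo ∘ f) ≈ 1#
    Π<-geo-inverse k {f} o = trans (sym (Π<-* k _ _)) (Π<-one k (λ i _ → geo-inverse (o i)))

    Π<-geo-divide : ∀ k {f a b} → (∀ i → Ord 1 (f i)) → Π< k (λ i → 1# - f i) * a ≈ b → a ≈ b * Π< k (geo ∘ f)
    Π<-geo-divide k {f} {a} {b} o p = begin
      a                                                   ≈⟨ *-identityˡ a ⟨
      1# * a                                              ≈⟨ *-congʳ (Π<-geo-inverse k o) ⟨
      Π< k (λ i → 1# - f i) * Π< k (geo ∘ f) * a
        ≈⟨ solve 3 (λ u g a → u :* g :* a := u :* a :* g) refl (Π< k (λ i → 1# - f i)) (Π< k (geo ∘ f)) a ⟩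
      Π< k (λ i → 1# - f i) * a * Π< k (geo ∘ f)          ≈⟨ *-congʳ p ⟩
      b * Π< k (geo ∘ f)                                  ∎

    -- The q-binomial theorem

    -- The q-Pochhammer symbol (a; Q)ᵢ. Below, `Π< i g` is the inverse of (Q; Q)ᵢ.
    poch : Carrier → ℕ → Carrier
    poch a i = Π< i (λ r → 1# - a * Q ^ r)

    g : ℕ → Carrier
    g j = geo (Q ^ suc j)

    -- The coefficient (a; Q)ᵢ / (Q; Q)ᵢ of Cauchy's q-binomial theorem, not a Gaussian binomial.
    binomialCoefficient : Carrier → ℕ → Carrier
    binomialCoefficient a i = poch a i * Π< i g

    binomialCoefficient-suc : ∀ a i →
      binomialCoefficient a (suc i) * (1# - Q ^ suc i) ≈ binomialCoefficient a i * (1# - a * Q ^ i)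
    binomialCoefficient-suc a i = begin
      (poch a i * u) * (Π< i g * g i) * (1# - Q ^ suc i)
        ≈⟨ solve 5 (λ p u r g w → (p :* u) :* (r :* g) :* w := p :* r :* u :* (w :* g)) refl (poch a i) u (Π< i g) (g i) (1# - Q ^ suc i) ⟩
      poch a i * Π< i g * u * ((1# - Q ^ suc i) * g i)
        ≈⟨ *-congˡ (geo-inverse (Ord-Q^ i)) ⟩
      poch a i * Π< i g * u * 1#
        ≈⟨ *-identityʳ _ ⟩
      binomialCoefficient a i * u ∎
      where
      u : Carrier
      u = 1# - a * Q ^ i

    binomialSeries : Carrier → Carrier → Carrier
    binomialSeries a s = Σ< (suc n) (λ i → binomialCoefficient a i * s ^ i)

    -- The functional equation (1 - s) F(s) = (1 - a s) F(s Q) for partial sums. With the exact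
    -- remainder kept it is an induction on `k`; for `s` divisible by y the remainder vanishes at k
    -- = n + 1.
    binomialSeries-partial : ∀ a s k →
      (1# - s) * Σ< k (λ i → binomialCoefficient a i * s ^ i) + binomialCoefficient a k * (1# - Q ^ k) * s ^ k
        ≈ (1# - a * s) * Σ< k (λ i → binomialCoefficient a i * (s * Q) ^ i)
    binomialSeries-partial a s zero =
      solve 3 (λ s a b → (con (+ 1) :- s) :* con (+ 0) :+ b :* (con (+ 1) :- con (+ 1)) :* con (+ 1)
        := (con (+ 1) :- a :* s) :* con (+ 0)) refl s a (binomialCoefficient a 0)
    binomialSeries-partial a s (suc k) = begin
      (1# - s) * (F + A * S) + A′ * (1# - Q ^ suc k) * (s * S)
        ≈⟨ +-congˡ (*-congʳ (binomialCoefficient-suc a k)) ⟩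
      (1# - s) * (F + A * S) + A * (1# - a * Q ^ k) * (s * S)
        ≈⟨ solve 6 (λ s F A S a t →
            (con (+ 1) :- s) :* (F :+ A :* S) :+ A :* (con (+ 1) :- a :* t) :* (s :* S)
              := ((con (+ 1) :- s) :* F :+ A :* (con (+ 1) :- t) :* S) :+ (con (+ 1) :- a :* s) :* (A :* (S :* t)))
            refl s F A S a (Q ^ k) ⟩
      ((1# - s) * F + A * (1# - Q ^ k) * S) + (1# - a * s) * (A * (S * Q ^ k))
        ≈⟨ +-cong (binomialSeries-partial a s k) (*-congˡ (*-congˡ (sym (^-distrib-* s Q k)))) ⟩
      (1# - a * s) * F′ + (1# - a * s) * (A * (s * Q) ^ k)
        ≈⟨ distribˡ _ _ _ ⟨
      (1# - a * s) * (F′ + A * (s * Q) ^ k) ∎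
      where
      F F′ A A′ S : Carrier
      F  = Σ< k (λ i → binomialCoefficient a i * s ^ i)
      F′ = Σ< k (λ i → binomialCoefficient a i * (s * Q) ^ i)
      A  = binomialCoefficient a k
      A′ = binomialCoefficient a (suc k)
      S  = s ^ k

    binomialSeries-shift : ∀ a {s} → Ord 1 s →
      (1# - s) * binomialSeries a s ≈ (1# - a * s) * binomialSeries a (s * Q)
    binomialSeries-shift a {s} o = trans
      (sym (trans (+-congˡ (trans (*-congˡ (Ord-vanish ℕ.≤-refl (Ord-^ (suc n) o))) (zeroʳ _))) (+-identityʳ _)))
      (binomialSeries-partial a s (suc n))

    binomialSeries-cong : ∀ a {s s′} → s ≈ s′ → binomialSeries a s ≈ binomialSeries a s′
    binomialSeries-cong a e = Σ<-cong (suc n) (λ i _ → *-congˡ (^-congˡ i e))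

    binomialSeries-0 : ∀ a → binomialSeries a 0# ≈ 1#
    binomialSeries-0 a = begin
      binomialSeries a 0#                                              ≈⟨ Σ<-front n _ ⟩
      1# * 1# * 1# + Σ< n (λ i → binomialCoefficient a (suc i) * (0# * 0# ^ i))
        ≈⟨ +-cong (trans (*-identityʳ _) (*-identityʳ _)) (Σ<-zero n (λ i _ → trans (*-congˡ (zeroˡ _)) (zeroʳ _))) ⟩
      1# + 0#                                                          ≈⟨ +-identityʳ _ ⟩
      1#                                                               ∎

    binomialSeries-shifts : ∀ a {t} → Ord 1 t → ∀ k →
      Π< k (λ r → 1# - t * Q ^ r) * binomialSeries a t ≈ Π< k (λ r → 1# - a * (t * Q ^ r)) * binomialSeries a (t * Q ^ k)
    binomialSeries-shifts a {t} o zero = *-congˡ (binomialSeries-cong a (sym (*-identityʳ t)))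
    binomialSeries-shifts a {t} o (suc k) = begin
      P * w * binomialSeries a t                       ≈⟨ solve 3 (λ p w f → p :* w :* f := p :* f :* w) refl P w (binomialSeries a t) ⟩
      P * binomialSeries a t * w                       ≈⟨ *-congʳ (binomialSeries-shifts a o k) ⟩
      P′ * binomialSeries a (t * Q ^ k) * w            ≈⟨ solve 3 (λ p f w → p :* f :* w := p :* (w :* f)) refl P′ _ w ⟩
      P′ * (w * binomialSeries a (t * Q ^ k))          ≈⟨ *-congˡ (binomialSeries-shift a (Ord-*ʳ (Q ^ k) o)) ⟩
      P′ * (w′ * binomialSeries a (t * Q ^ k * Q))     ≈⟨ *-congˡ (*-congˡ (binomialSeries-cong a (trans (*-assoc _ _ _) (*-congˡ (*-comm _ _))))) ⟩
      P′ * (w′ * binomialSeries a (t * Q ^ suc k))     ≈⟨ *-assoc _ _ _ ⟨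
      P′ * w′ * binomialSeries a (t * Q ^ suc k)       ∎
      where
      P P′ w w′ : Carrier
      P  = Π< k (λ r → 1# - t * Q ^ r)
      P′ = Π< k (λ r → 1# - a * (t * Q ^ r))
      w  = 1# - t * Q ^ k
      w′ = 1# - a * (t * Q ^ k)

    -- After `n` uses of the functional equation the argument is t Qⁿ, of order n + 1 and hence
    -- zero, and F(0) = 1.
    qBinomial : ∀ a {t} → Ord 1 t →
      binomialSeries a t ≈ Π< n (λ r → 1# - a * (t * Q ^ r)) * Π< n (λ r → geo (t * Q ^ r))
    qBinomial a {t} o = Π<-geo-divide n (λ r → Ord-*ʳ (Q ^ r) o) (begin
      Π< n (λ r → 1# - t * Q ^ r) * binomialSeries a t                     ≈⟨ binomialSeries-shifts a o n ⟩
      Π< n (λ r → 1# - a * (t * Q ^ r)) * binomialSeries a (t * Q ^ n)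
        ≈⟨ *-congˡ (trans (binomialSeries-cong a (Ord-vanish ℕ.≤-refl (Ord-* o (Ord-^ n Ord-Q)))) (binomialSeries-0 a)) ⟩
      Π< n (λ r → 1# - a * (t * Q ^ r)) * 1#                               ≈⟨ *-identityʳ _ ⟩
      Π< n (λ r → 1# - a * (t * Q ^ r))                                    ∎)

    -- Gauss's identity

    odd : ℕ → Carrier
    odd j = q * Q ^ j

    Ord-odd : ∀ j → Ord 1 (odd j)
    Ord-odd j = Ord-*ʳ (Q ^ j) Ord-q

    -- The factor (1 - Qʲ⁺¹)/(1 - q²ʲ⁺¹) of the product in Gauss's identity, and its inverse.
    ρ ρ⁻¹ : ℕ → Carrier
    ρ   j = (1# - Q ^ suc j) * geo (odd j)
    ρ⁻¹ j = (1# - odd j) * g j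

    Π<-ρ-inverse : ∀ k → Π< k ρ * Π< k ρ⁻¹ ≈ 1#
    Π<-ρ-inverse k = trans (sym (Π<-* k ρ ρ⁻¹)) (Π<-one k (λ j _ → begin
      (1# - Q ^ suc j) * geo (odd j) * ((1# - odd j) * g j)
        ≈⟨ solve 4 (λ a b d e → a :* b :* (d :* e) := (a :* e) :* (d :* b)) refl (1# - Q ^ suc j) (geo (odd j)) (1# - odd j) (g j) ⟩
      ((1# - Q ^ suc j) * g j) * ((1# - odd j) * geo (odd j))
        ≈⟨ *-cong (geo-inverse (Ord-Q^ j)) (geo-inverse (Ord-odd j)) ⟩
      1# * 1# ≈⟨ *-identityˡ _ ⟩
      1# ∎))

    odd*odd : ∀ j k → odd j * odd k ≈ Q ^ j * Q ^ suc k
    odd*odd j k = solve 3 (λ q a b → (q :* a) :* (q :* b) := a :* (q :* q :* b)) refl q (Q ^ j) (Q ^ k)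

    -- Shanks' finite form: with P the partial products of `ρ`, the terms (P k / P s) · q^(s(2k+1))
    -- with s < k add up to the first 2k terms of Σ q^(i(i+1)/2).
    gaussTerm : ℕ → ℕ → Carrier
    gaussTerm k s = Π< k ρ * Π< s ρ⁻¹ * odd k ^ s

    gaussSum : ℕ → Carrier
    gaussSum k = Σ< k (gaussTerm k)

    -- Shanks: as k grows by one, the terms of gaussSum k change by a telescoping amount.
    gaussTerm-telescope : ∀ k N →
      Σ< N (gaussTerm (suc k))
        ≈ Σ< N (gaussTerm k) + Π< k ρ * Π< N ρ⁻¹ * (1# - Q ^ N) * odd k ^ N * geo (odd k)
    gaussTerm-telescope k zero =
      solve 2 (λ a b → con (+ 0) := con (+ 0) :+ a :* con (+ 1) :* (con (+ 1) :- con (+ 1)) :* con (+ 1) :* b)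
        refl (Π< k ρ) (geo (odd k))
    gaussTerm-telescope k (suc N) = begin
      Σ< N (gaussTerm (suc k)) + P * (u * γ) * I * odd (suc k) ^ N
        ≈⟨ +-cong (gaussTerm-telescope k N) (*-congˡ odd-suc^) ⟩
      (S + P * I * (1# - t) * o * γ) + P * (u * γ) * I * (o * t)
        ≈⟨ solve 8 (λ S P I t o γ w x →
             (S :+ P :* I :* (con (+ 1) :- t) :* o :* γ) :+ P :* ((con (+ 1) :- w) :* γ) :* I :* (o :* t)
             := (S :+ P :* I :* o :* ((con (+ 1) :- x) :* γ)) :+ P :* I :* o :* γ :* (x :- t :* w))
             refl S P I t o γ (Q ^ suc k) x ⟩
      (S + P * I * o * ((1# - x) * γ)) + P * I * o * γ * (x - t * Q ^ suc k)
        ≈⟨ +-cong (+-congˡ (trans (*-congˡ (geo-inverse (Ord-odd k))) (*-identityʳ _)))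
                  (*-congˡ (+-congˡ (-‿cong (sym (odd*odd N k))))) ⟩
      (S + P * I * o) + P * I * o * γ * (x - odd N * x)
        ≈⟨ solve 7 (λ S P I o γ x w → (S :+ P :* I :* o) :+ P :* I :* o :* γ :* (x :- w :* x)
             := (S :+ P :* I :* o) :+ P :* I :* ((con (+ 1) :- w) :* con (+ 1)) :* (x :* o) :* γ)
             refl S P I o γ x (odd N) ⟩
      (S + P * I * o) + P * I * ((1# - odd N) * 1#) * (x * o) * γ
        ≈⟨ +-congˡ (*-congʳ (*-congʳ (*-congˡ (*-congˡ (geo-inverse (Ord-Q^ N)))))) ⟨
      (S + P * I * o) + P * I * ((1# - odd N) * ((1# - Q ^ suc N) * g N)) * (x * o) * γ
        ≈⟨ +-congˡ (*-congʳ (*-congʳ (solve 5 (λ P I a b e → P :* I :* (a :* (b :* e)) := P :* (I :* (a :* e)) :* b)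
             refl P I (1# - odd N) (1# - Q ^ suc N) (g N)))) ⟩
      (S + P * I * o) + P * (I * ((1# - odd N) * g N)) * (1# - Q ^ suc N) * (x * o) * γ ∎
      where
      S P I t o γ x u : Carrier
      S = Σ< N (gaussTerm k)
      P = Π< k ρ
      I = Π< N ρ⁻¹
      t = Q ^ N
      x = odd k
      o = odd k ^ N
      γ = geo (odd k)
      u = 1# - Q ^ suc k
      odd-suc^ : odd (suc k) ^ N ≈ o * t
      odd-suc^ = trans (^-congˡ N (solve 3 (λ q Q a → q :* (Q :* a) := (q :* a) :* Q) refl q Q (Q ^ k))) (^-distrib-* x Q N)

    -- The increment is q^(k(2k+1)) + q^((k+1)(2k+1)), the triangular powers with indices 2k and 2k
    -- + 1. Being sums of powers of q, all `gaussSum k` lie in the cone `Pos`.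
    gaussSum-suc : ∀ k → gaussSum (suc k) ≈ gaussSum k + odd k ^ k * (1# + odd k)
    gaussSum-suc k = begin
      Σ< k (gaussTerm (suc k)) + P * (u * γ) * I * odd (suc k) ^ k
        ≈⟨ +-cong (gaussTerm-telescope k k) (*-congˡ odd-suc^) ⟩
      (gaussSum k + P * I * (1# - t) * o * γ) + P * (u * γ) * I * (o * t)
        -- The telescoped remainder meets the new term s = k: (1 - Qᵏ) + Qᵏ(1 - Qᵏ⁺¹) = 1 - Qᵏ ·
        -- Qᵏ⁺¹, which is 1 - (`odd k`)² and so divisible by the denominator of `γ`.
        ≈⟨ solve 7 (λ S P I t o γ w → (S :+ P :* I :* (con (+ 1) :- t) :* o :* γ) :+ P :* ((con (+ 1) :- w) :* γ) :* I :* (o :* t)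
             := S :+ (P :* I) :* (o :* (γ :* (con (+ 1) :- t :* w)))) refl (gaussSum k) P I t o γ (Q ^ suc k) ⟩
      gaussSum k + (P * I) * (o * (γ * (1# - t * Q ^ suc k)))
        ≈⟨ +-congˡ (*-cong (Π<-ρ-inverse k) (*-congˡ (*-congˡ (+-congˡ (-‿cong (sym (odd*odd k k))))))) ⟩
      gaussSum k + 1# * (o * (γ * (1# - odd k * odd k)))
        ≈⟨ +-congˡ (solve 3 (λ o γ x → con (+ 1) :* (o :* (γ :* (con (+ 1) :- x :* x)))
             := o :* ((con (+ 1) :- x) :* γ :* (con (+ 1) :+ x))) refl o γ (odd k)) ⟩
      gaussSum k + o * ((1# - odd k) * γ * (1# + odd k))
        ≈⟨ +-congˡ (*-congˡ (trans (*-congʳ (geo-inverse (Ord-odd k))) (*-identityˡ _))) ⟩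
      gaussSum k + o * (1# + odd k) ∎
      where
      P I t o γ u : Carrier
      P = Π< k ρ
      I = Π< k ρ⁻¹
      t = Q ^ k
      o = odd k ^ k
      γ = geo (odd k)
      u = 1# - Q ^ suc k
      odd-suc^ : odd (suc k) ^ k ≈ o * t
      odd-suc^ = trans (^-congˡ k (solve 3 (λ q Q a → q :* (Q :* a) := (q :* a) :* Q) refl q Q (Q ^ k))) (^-distrib-* (odd k) Q k)

    odd-n : odd n ≈ 0#
    odd-n = Ord-vanish ℕ.≤-refl (Ord-* Ord-q (Ord-^ n Ord-Q))

    -- At k = n the element `odd n` has order n + 1 and is zero, so only the term s = 0, which is
    -- the product itself, survives.
    gaussSum-n : gaussSum n ≈ Π< n ρ
    gaussSum-n = begin
      gaussSum n                                             ≈⟨ Σ<-front n′ (gaussTerm n) ⟩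
      Π< n ρ * 1# * 1# + Σ< n′ (λ s → gaussTerm n (suc s))
        ≈⟨ +-cong (trans (*-identityʳ _) (*-identityʳ _))
                  (Σ<-zero n′ (λ s _ → trans (*-congˡ (trans (*-congʳ odd-n) (zeroˡ _))) (zeroʳ _))) ⟩
      Π< n ρ + 0#                                            ≈⟨ +-identityʳ _ ⟩
      Π< n ρ                                                 ∎

    -- The cone of nonnegative combinations of the elements q^a χ_k with χ_k = z^-k + ... + z^k

    w : Carrier
    w = z * z

    -- σ k = 1 + z + ... + z^2k, so that y ^ k * σ k is q ^ k χ_k.
    σ : ℕ → Carrier
    σ zero    = 1#
    σ (suc k) = σ k + z * w ^ k * (1# + z)

    σ-front : ∀ k → σ (suc k) ≈ 1# + z + w * σ k
    σ-front zero    = solve 1 (λ z → con (+ 1) :+ z :* con (+ 1) :* (con (+ 1) :+ z) := con (+ 1) :+ z :+ z :* z :* con (+ 1)) refl z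
    σ-front (suc k) = trans (+-congʳ (σ-front k))
      (solve 4 (λ z s w t → con (+ 1) :+ z :+ w :* s :+ z :* (w :* t) :* (con (+ 1) :+ z)
        := con (+ 1) :+ z :+ w :* (s :+ z :* t :* (con (+ 1) :+ z))) refl z (σ k) w (w ^ k))

    -- The bracket joins two runs of powers into 1 + z + ... + z^M with M = 2k + 2l + 3. Multiplied
    -- by 1 + z it covers 0, ..., M + 1 once and 1, ..., M once more.
    σ-append : ∀ k l → (1# + z) * (σ (suc l) + z * w ^ suc l * σ k) ≈ σ (suc (suc (k ℕ.+ l))) + z * σ (suc (k ℕ.+ l))
    σ-append zero l = solve 3 (λ z s t → (con (+ 1) :+ z) :* (s :+ z :* t :* con (+ 1))
      := (s :+ z :* t :* (con (+ 1) :+ z)) :+ z :* s) refl z (σ (suc l)) (w ^ suc l)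
    σ-append (suc k) l = begin
      (1# + z) * (σ (suc l) + z * w ^ suc l * (σ k + z * w ^ k * (1# + z)))
        ≈⟨ solve 5 (λ z s t r u → (con (+ 1) :+ z) :* (s :+ z :* t :* (r :+ z :* u :* (con (+ 1) :+ z)))
             := (con (+ 1) :+ z) :* (s :+ z :* t :* r) :+ z :* z :* (con (+ 1) :+ z) :* (con (+ 1) :+ z) :* (t :* u))
             refl z (σ (suc l)) (w ^ suc l) (σ k) (w ^ k) ⟩
      (1# + z) * (σ (suc l) + z * w ^ suc l * σ k) + z * z * (1# + z) * (1# + z) * (w ^ suc l * w ^ k)
        ≈⟨ +-cong (σ-append k l) (*-congˡ (trans (*-comm _ _) (trans (sym (^-homo-* w k (suc l))) (^-congʳ w (ℕ.+-suc k l))))) ⟩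
      (σ (suc (suc (k ℕ.+ l))) + z * σ (suc (k ℕ.+ l))) + z * z * (1# + z) * (1# + z) * w ^ suc (k ℕ.+ l)
        ≈⟨ solve 4 (λ z s r t → (s :+ z :* r) :+ z :* z :* (con (+ 1) :+ z) :* (con (+ 1) :+ z) :* (z :* z :* t)
             := (s :+ z :* (z :* z :* (z :* z :* t)) :* (con (+ 1) :+ z)) :+ z :* (r :+ z :* (z :* z :* t) :* (con (+ 1) :+ z)))
             refl z (σ (suc (suc (k ℕ.+ l)))) (σ (suc (k ℕ.+ l))) (w ^ (k ℕ.+ l)) ⟩
      σ (suc (suc (suc k ℕ.+ l))) + z * σ (suc (suc k ℕ.+ l)) ∎

    -- In the decomposition of χ_a χ_b into χ_|a-b|, ..., χ_{a+b}, lowering both indices by one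
    -- removes just the two top constituents.
    σ-product : ∀ k l → σ (suc k) * σ (suc l) ≈ σ (suc (suc (k ℕ.+ l))) + z * σ (suc (k ℕ.+ l)) + w * (σ k * σ l)
    σ-product k l = begin
      σ (suc k) * σ (suc l)
        ≈⟨ *-congʳ (σ-front k) ⟩
      (1# + z + w * σ k) * (σ l + z * w ^ l * (1# + z))
        ≈⟨ solve 5 (λ z w s r t → (con (+ 1) :+ z :+ w :* s) :* (r :+ z :* t :* (con (+ 1) :+ z))
             := (con (+ 1) :+ z) :* ((r :+ z :* t :* (con (+ 1) :+ z)) :+ z :* (w :* t) :* s) :+ w :* (s :* r))
             refl z w (σ k) (σ l) (w ^ l) ⟩
      (1# + z) * (σ (suc l) + z * w ^ suc l * σ k) + w * (σ k * σ l)
        ≈⟨ +-congʳ (σ-append k l) ⟩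
      σ (suc (suc (k ℕ.+ l))) + z * σ (suc (k ℕ.+ l)) + w * (σ k * σ l) ∎

    -- `generator a k` is q^(a+k) χ_k: the exponent of q is at least the index, so no negative power
    -- of z appears. As an inductive predicate, it lets coefficients be compared by induction on the
    -- derivation.
    data Pos : Carrier → Set (c ⊔ ℓ) where
      generator : ∀ a k → Pos (q ^ a * (y ^ k * σ k))
      Pos-0     : Pos 0#
      Pos-+     : ∀ {f h} → Pos f → Pos h → Pos (f + h)
      Pos-≈     : ∀ {f h} → f ≈ h → Pos f → Pos h

    Pos-σ : ∀ k → Pos (y ^ k * σ k)
    Pos-σ k = Pos-≈ (*-identityˡ _) (generator 0 k)

    Pos-1 : Pos 1#
    Pos-1 = Pos-≈ (*-identityˡ _) (Pos-σ 0)

    Pos-q^* : ∀ a {f} → Pos f → Pos (q ^ a * f)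
    Pos-q^* a (generator b k) = Pos-≈ (trans (*-congʳ (^-homo-* q a b)) (*-assoc _ _ _)) (generator (a ℕ.+ b) k)
    Pos-q^* a Pos-0           = Pos-≈ (sym (zeroʳ _)) Pos-0
    Pos-q^* a (Pos-+ f h)     = Pos-≈ (sym (distribˡ _ _ _)) (Pos-+ (Pos-q^* a f) (Pos-q^* a h))
    Pos-q^* a (Pos-≈ e f)     = Pos-≈ (*-congˡ e) (Pos-q^* a f)

    Pos-q* : ∀ {f} → Pos f → Pos (q * f)
    Pos-q* f = Pos-≈ (*-congʳ (*-identityʳ q)) (Pos-q^* 1 f)

    -- Clebsch–Gordan: χ_k χ_l = χ_{k+l} + χ_{k+l-1} + χ_{k-1} χ_{l-1}.
    Pos-σ*σ : ∀ k l → Pos ((y ^ k * σ k) * (y ^ l * σ l))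
    Pos-σ*σ zero    l       = Pos-≈ (trans (sym (*-identityˡ _)) (*-congʳ (sym (*-identityˡ _)))) (Pos-σ l)
    Pos-σ*σ (suc k) zero    = Pos-≈ (trans (sym (*-identityʳ _)) (*-congˡ (sym (*-identityˡ _)))) (Pos-σ (suc k))
    Pos-σ*σ (suc k) (suc l) = Pos-≈ (begin
      y ^ suc (suc (k ℕ.+ l)) * A + q * (y ^ suc (k ℕ.+ l) * B) + q * (q * ((y ^ k * σ k) * (y ^ l * σ l)))
        ≈⟨ +-congʳ (+-cong (*-congʳ (*-congˡ (*-congˡ split))) (*-congˡ (*-congʳ (*-congˡ split)))) ⟩
      y * (y * (Y * Y′)) * A + q * (y * (Y * Y′) * B) + q * (q * ((Y * σ k) * (Y′ * σ l)))
        ≈⟨ solve 8 (λ z y Y Y′ A B s t →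
             y :* (y :* (Y :* Y′)) :* A :+ z :* y :* (y :* (Y :* Y′) :* B) :+ z :* y :* (z :* y :* ((Y :* s) :* (Y′ :* t)))
             := (y :* Y) :* (y :* Y′) :* (A :+ z :* B :+ z :* z :* (s :* t)))
             refl z y Y Y′ A B (σ k) (σ l) ⟩
      (y * Y) * (y * Y′) * (A + z * B + w * (σ k * σ l))
        ≈⟨ *-congˡ (σ-product k l) ⟨
      (y * Y) * (y * Y′) * (σ (suc k) * σ (suc l))
        ≈⟨ interchange _ _ _ _ ⟩
      (y * Y * σ (suc k)) * (y * Y′ * σ (suc l)) ∎)
      (Pos-+ (Pos-+ (Pos-σ (suc (suc (k ℕ.+ l)))) (Pos-q* (Pos-σ (suc (k ℕ.+ l))))) (Pos-q* (Pos-q* (Pos-σ*σ k l))))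
      where
      Y Y′ A B : Carrier
      Y  = y ^ k
      Y′ = y ^ l
      A  = σ (suc (suc (k ℕ.+ l)))
      B  = σ (suc (k ℕ.+ l))
      split : y ^ (k ℕ.+ l) ≈ Y * Y′
      split = ^-homo-* y k l

    Pos-* : ∀ {f h} → Pos f → Pos h → Pos (f * h)
    Pos-* Pos-0       p = Pos-≈ (sym (zeroˡ _)) Pos-0
    Pos-* (Pos-+ f h) p = Pos-≈ (sym (distribʳ _ _ _)) (Pos-+ (Pos-* f p) (Pos-* h p))
    Pos-* (Pos-≈ e f) p = Pos-≈ (*-congʳ e) (Pos-* f p)
    Pos-* (generator a k) Pos-0       = Pos-≈ (sym (zeroʳ _)) Pos-0
    Pos-* (generator a k) (Pos-+ f h) = Pos-≈ (sym (distribˡ _ _ _)) (Pos-+ (Pos-* (generator a k) f) (Pos-* (generator a k) h))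
    Pos-* (generator a k) (Pos-≈ e f) = Pos-≈ (*-congˡ e) (Pos-* (generator a k) f)
    Pos-* (generator a k) (generator b l) = Pos-≈
      (trans (sym (*-assoc _ _ _)) (interchange _ _ _ _)) (Pos-q^* a (Pos-q^* b (Pos-σ*σ k l)))

    Pos-^ : ∀ k {f} → Pos f → Pos (f ^ k)
    Pos-^ zero    f = Pos-1
    Pos-^ (suc k) f = Pos-* f (Pos-^ k f)

    Pos-Σ< : ∀ k {f} → (∀ i → Pos (f i)) → Pos (Σ< k f)
    Pos-Σ< zero    p = Pos-0
    Pos-Σ< (suc k) p = Pos-+ (Pos-Σ< k p) (p k)

    Pos-Π< : ∀ k {f} → (∀ i → Pos (f i)) → Pos (Π< k f)
    Pos-Π< zero    p = Pos-1
    Pos-Π< (suc k) p = Pos-* (Pos-Π< k p) (p k)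

    Pos-q : Pos q
    Pos-q = Pos-≈ (*-identityʳ q) (Pos-q* Pos-1)

    Pos-odd : ∀ j → Pos (odd j)
    Pos-odd j = Pos-q* (Pos-^ j (Pos-q* Pos-q))

    Pos-gauss : Pos (Π< n ρ)
    Pos-gauss = Pos-≈ gaussSum-n (pos n)
      where
      pos : ∀ k → Pos (gaussSum k)
      pos zero    = Pos-0
      pos (suc k) = Pos-≈ (sym (gaussSum-suc k)) (Pos-+ (pos k) (Pos-* (Pos-^ k (Pos-odd k)) (Pos-+ Pos-1 (Pos-odd k))))

    -- (1 + x) / ((1 - z x) (1 - x / z)) = Σ x^i χ_i, for x = z x′.
    σ-series-partial : ∀ x′ k →
      (1# - x′) * Σ< (suc k) (λ i → x′ ^ i * σ i) + x′ * (x′ ^ k * σ k)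
        ≈ Σ< (suc k) ((w * x′) ^_) + z * x′ * Σ< k ((w * x′) ^_)
    σ-series-partial x′ zero =
      solve 2 (λ x z → (con (+ 1) :- x) :* (con (+ 0) :+ con (+ 1) :* con (+ 1)) :+ x :* (con (+ 1) :* con (+ 1))
        := con (+ 0) :+ con (+ 1) :+ z :* x :* con (+ 0)) refl x′ z
    σ-series-partial x′ (suc k) = begin
      (1# - x′) * (S + x′ ^ suc k * σ (suc k)) + x′ * (x′ ^ suc k * σ (suc k))
        ≈⟨ solve 6 (λ x S t s z u →
             (con (+ 1) :- x) :* (S :+ (x :* t) :* (s :+ z :* u :* (con (+ 1) :+ z))) :+ x :* ((x :* t) :* (s :+ z :* u :* (con (+ 1) :+ z)))
             := ((con (+ 1) :- x) :* S :+ x :* (t :* s)) :+ (z :* z :* x :+ z :* x) :* (u :* t))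
             refl x′ S (x′ ^ k) (σ k) z (w ^ k) ⟩
      ((1# - x′) * S + x′ * (x′ ^ k * σ k)) + (w * x′ + z * x′) * (w ^ k * x′ ^ k)
        ≈⟨ +-cong (σ-series-partial x′ k) (*-congˡ (sym (^-distrib-* w x′ k))) ⟩
      (G + z * x′ * G′) + (w * x′ + z * x′) * (w * x′) ^ k
        ≈⟨ solve 5 (λ G G′ a b t → (G :+ b :* G′) :+ (a :+ b) :* t := (G :+ a :* t) :+ b :* (G′ :+ t)) refl G G′ (w * x′) (z * x′) ((w * x′) ^ k) ⟩
      (G + (w * x′) ^ suc k) + z * x′ * (G′ + (w * x′) ^ k) ∎
      where
      S G G′ : Carrier
      S  = Σ< (suc k) (λ i → x′ ^ i * σ i)
      G  = Σ< (suc k) ((w * x′) ^_)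
      G′ = Σ< k ((w * x′) ^_)

    σ-series : ∀ {x′} → Ord 1 x′ →
      Σ< (suc n) (λ i → x′ ^ i * σ i) ≈ (1# + z * x′) * geo (w * x′) * geo x′
    σ-series {x′} o = geo-divide o (begin
      (1# - x′) * S                                   ≈⟨ +-identityʳ _ ⟨
      (1# - x′) * S + 0#
        ≈⟨ +-congˡ (trans (sym (*-assoc _ _ _)) (trans (*-congʳ (Ord-vanish ℕ.≤-refl (Ord-^ (suc n) o))) (zeroˡ _))) ⟨
      (1# - x′) * S + x′ * (x′ ^ n * σ n)             ≈⟨ σ-series-partial x′ n ⟩
      geo u + z * x′ * G                              ≈⟨ +-identityʳ _ ⟨
      geo u + z * x′ * G + 0#
        -- The vanishing term z x′ uⁿ makes the second geometric sum as long as the first, so that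
        -- both become `geo u`.
        ≈⟨ +-congˡ (Ord-vanish ℕ.≤-refl (Ord-* (Ord-*ˡ z o) (Ord-^ n (Ord-*ˡ w o)))) ⟨
      geo u + z * x′ * G + z * x′ * u ^ n
        ≈⟨ solve 3 (λ b G t → G :+ t :+ b :* G :+ b :* t := (con (+ 1) :+ b) :* (G :+ t)) refl (z * x′) G (u ^ n) ⟩
      (1# + z * x′) * geo u                           ∎)
      where
      S u G : Carrier
      S = Σ< (suc n) (λ i → x′ ^ i * σ i)
      u = w * x′
      G = Σ< n (u ^_)

    Φ : ℕ → Carrier
    Φ j = (1# + Q ^ suc j) * geo (z * Q ^ suc j) * geo (v * Q ^ j)

    -- Take x′ = v Qʲ in `σ-series`: then z x′ = Qʲ⁺¹ and w x′ = z Qʲ⁺¹. Since x′ = `odd j` · y, the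
    -- i-th term is a power of q times the generator yⁱ σᵢ.
    Pos-Φ : ∀ j → Pos (Φ j)
    Pos-Φ j = Pos-≈ (begin
      Σ< (suc n) (λ i → (v * Q ^ j) ^ i * σ i)
        ≈⟨ σ-series (Ord-*ʳ (Q ^ j) Ord-v) ⟩
      (1# + z * (v * Q ^ j)) * geo (w * (v * Q ^ j)) * geo (v * Q ^ j)
        ≈⟨ *-congʳ (*-cong (+-congˡ (solve 3 (λ z y t → z :* (z :* y :* y :* t) := z :* y :* (z :* y) :* t) refl z y (Q ^ j)))
                           (geo-cong (solve 3 (λ z y t → z :* z :* (z :* y :* y :* t) := z :* (z :* y :* (z :* y) :* t)) refl z y (Q ^ j)))) ⟩
      Φ j ∎)
      (Pos-Σ< (suc n) (λ i → Pos-≈ (begin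
         odd j ^ i * (y ^ i * σ i)     ≈⟨ *-assoc _ _ _ ⟨
         odd j ^ i * y ^ i * σ i       ≈⟨ *-congʳ (^-distrib-* (odd j) y i) ⟨
         (odd j * y) ^ i * σ i         ≈⟨ *-congʳ (^-congˡ i (solve 3 (λ q t y → q :* t :* y := q :* y :* t) refl q (Q ^ j) y)) ⟩
         (v * Q ^ j) ^ i * σ i         ∎)
         (Pos-* (Pos-^ i (Pos-odd j)) (Pos-σ i))))

    -- The crank generating function

    zQ : Carrier
    zQ = z * Q

    Ord-zQ : Ord 1 zQ
    Ord-zQ = Ord-*ˡ z Ord-Q

    -- Weight of a part p of a partition with ω ones.
    φ : ℕ → ℕ → Carrier
    φ ω p = if ω ℕ.<ᵇ p then z * Q ^ p else Q ^ p

    h : ℕ → Carrier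
    h j = geo (z * Q ^ suc j)

    <ᵇ-false : ∀ {j k} → k ℕ.≤ j → (j ℕ.<ᵇ k) ≡ false
    <ᵇ-false {j}     {zero}  _         = ≡.refl
    <ᵇ-false {suc j} {suc k} (s≤s k≤j) = <ᵇ-false k≤j

    <ᵇ-true : ∀ j d → (j ℕ.<ᵇ suc (j ℕ.+ d)) ≡ true
    <ᵇ-true zero    d = ≡.refl
    <ᵇ-true (suc j) d = <ᵇ-true j d

    poch-h-inverse : ∀ k → poch zQ k * Π< k h ≈ 1#
    poch-h-inverse k = trans
      (*-congʳ (Π<-cong k (λ i _ → +-congˡ (-‿cong (*-assoc z Q (Q ^ i))))))
      (Π<-geo-inverse k (λ i → Ord-*ˡ z (Ord-Q^ i)))

    -- Start from the product of all 1/(1 - z Qᵖ); for the parts p ≤ ω, which carry no z, replace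
    -- 1/(1 - z Qᵖ) by 1/(1 - Qᵖ). The exchanged factors form the q-binomial coefficient with a =
    -- zQ.
    Π<-geo-φ : ∀ ω d → Π< (ω ℕ.+ d) (λ i → geo (φ ω (suc i))) ≈ binomialCoefficient zQ ω * Π< (ω ℕ.+ d) h
    Π<-geo-φ ω zero rewrite ℕ.+-identityʳ ω = begin
      Π< ω (λ i → geo (φ ω (suc i)))       ≈⟨ Π<-cong ω (λ i i<ω → geo-cong (reflexive (≡.cong (λ b → if b then z * Q ^ suc i else Q ^ suc i) (<ᵇ-false i<ω)))) ⟩
      Π< ω g                               ≈⟨ *-identityˡ _ ⟨
      1# * Π< ω g                          ≈⟨ *-congʳ (poch-h-inverse ω) ⟨
      poch zQ ω * Π< ω h * Π< ω g          ≈⟨ solve 3 (λ a b d → a :* b :* d := a :* d :* b) refl (poch zQ ω) (Π< ω h) (Π< ω g) ⟩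
      binomialCoefficient zQ ω * Π< ω h    ∎
    Π<-geo-φ ω (suc d) rewrite ℕ.+-suc ω d = trans
      (*-cong (Π<-geo-φ ω d) (geo-cong (reflexive (≡.cong (λ b → if b then z * Q ^ suc (ω ℕ.+ d) else Q ^ suc (ω ℕ.+ d)) (<ᵇ-true ω d)))))
      (*-assoc _ _ _)

    -- The product omits part 1, whose factor would be 1/(1 - Q) because 1 does not exceed the
    -- number of ones; 1 - Q compensates for it.
    onesTerm : ∀ ω → ω ℕ.< n →
      Π< n′ (λ i → geo (φ (suc ω) (suc (suc i)))) ≈ (1# - Q) * (binomialCoefficient zQ (suc ω) * Π< n h)
    onesTerm ω ω<n = begin
      P                                          ≈⟨ *-identityˡ P ⟨
      1# * P                                     ≈⟨ *-congʳ (geo-inverse Ord-Q) ⟨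
      (1# - Q) * geo Q * P                       ≈⟨ *-assoc _ _ _ ⟩
      (1# - Q) * (geo Q * P)                     ≈⟨ *-congˡ (*-congʳ (geo-cong (sym (*-identityʳ Q)))) ⟩
      (1# - Q) * (geo (Q ^ 1) * P)               ≈⟨ *-congˡ (Π<-front n′ (λ i → geo (φ (suc ω) (suc i)))) ⟨
      (1# - Q) * Π< n (λ i → geo (φ (suc ω) (suc i)))
        ≈⟨ *-congˡ (≡.subst (λ k → Π< k (λ i → geo (φ (suc ω) (suc i))) ≈ binomialCoefficient zQ (suc ω) * Π< k h)
                            (ℕ.m+[n∸m]≡n ω<n) (Π<-geo-φ (suc ω) (n ℕ.∸ suc ω))) ⟩
      (1# - Q) * (binomialCoefficient zQ (suc ω) * Π< n h) ∎
      where
      P : Carrier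
      P = Π< n′ (λ i → geo (φ (suc ω) (suc (suc i))))

    -- Partitions with parts in j + 1, ..., j + L, counted with weight z ^ (max c (largest part)).
    largestPartSum : ℕ → ℕ → ℕ → Carrier
    largestPartSum c j zero    = z ^ c
    -- Either part j + 1 is absent and `c` stays, or it occurs at least once and j + 1 takes over as
    -- the running maximum; this reading supposes c ≤ j + 1.
    largestPartSum c j (suc L) = largestPartSum c (suc j) L + Q ^ suc j * g j * largestPartSum (suc j) (suc j) L

    -- The nonempty partitions, weighted by z to the largest part: either all parts are j + 1, one
    -- copy being mandatory, or a nonempty partition into larger parts remains.
    largestPartTail : ℕ → ℕ → Carrier
    largestPartTail j zero    = 0#
    largestPartTail j (suc L) = g j * (zQ ^ suc j + largestPartTail (suc j) L)

    largestPartSum-tail : ∀ c j L → largestPartSum c j L ≈ z ^ c + largestPartTail j L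
    largestPartSum-tail c j zero    = sym (+-identityʳ _)
    largestPartSum-tail c j (suc L) = begin
      largestPartSum c (suc j) L + x * g j * largestPartSum (suc j) (suc j) L
        ≈⟨ +-cong (largestPartSum-tail c (suc j) L) (*-congˡ (largestPartSum-tail (suc j) (suc j) L)) ⟩
      (z ^ c + T) + x * g j * (z ^ suc j + T)
        ≈⟨ solve 5 (λ a T x g b → (a :+ T) :+ x :* g :* (b :+ T) := a :+ (g :* (b :* x) :+ (con (+ 1) :+ x :* g) :* T)) refl (z ^ c) T x (g j) (z ^ suc j) ⟩
      z ^ c + (g j * (z ^ suc j * x) + (1# + x * g j) * T)
        ≈⟨ +-congˡ (+-cong (*-congˡ (sym (^-distrib-* z Q (suc j)))) (*-congʳ (geo-unfold (Ord-Q^ j)))) ⟩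
      z ^ c + (g j * zQ ^ suc j + g j * T)
        ≈⟨ +-congˡ (distribˡ _ _ _) ⟨
      z ^ c + g j * (zQ ^ suc j + T) ∎
      where
      x T : Carrier
      x = Q ^ suc j
      T = largestPartTail (suc j) L

    -- Solves the recursion by the size of the largest part; the prefix `Π< j g` completes each
    -- product to 1/(Q; Q).
    largestPartTail-sum : ∀ j L → Π< j g * largestPartTail j L ≈ Σ< L (λ i → Π< (suc (j ℕ.+ i)) g * zQ ^ suc (j ℕ.+ i))
    largestPartTail-sum j zero    = zeroʳ _
    largestPartTail-sum j (suc L) = begin
      Π< j g * (g j * (zQ ^ suc j + largestPartTail (suc j) L))
        ≈⟨ solve 4 (λ P g a T → P :* (g :* (a :+ T)) := P :* g :* a :+ P :* g :* T) refl (Π< j g) (g j) (zQ ^ suc j) _ ⟩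
      F j + Π< (suc j) g * largestPartTail (suc j) L
        ≈⟨ +-cong (reflexive (≡.cong F (≡.sym (ℕ.+-identityʳ j)))) (largestPartTail-sum (suc j) L) ⟩
      F (j ℕ.+ 0) + Σ< L (λ i → F (suc (j ℕ.+ i)))
        ≈⟨ +-congˡ (Σ<-cong L (λ i _ → reflexive (≡.cong F (≡.sym (ℕ.+-suc j i))))) ⟩
      F (j ℕ.+ 0) + Σ< L (λ i → F (j ℕ.+ suc i))
        ≈⟨ Σ<-front L (λ i → F (j ℕ.+ i)) ⟨
      Σ< (suc L) (λ i → F (j ℕ.+ i)) ∎
      where
      F : ℕ → Carrier
      F i = Π< (suc i) g * zQ ^ suc i

    -- Euler's Σ (zQ)ⁱ/(Q; Q)ᵢ = 1/(zQ; Q), the q-binomial theorem at a = 0: counting by largest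
    -- part agrees with counting by number of parts.
    euler : 1# + largestPartTail 0 n ≈ Π< n h
    euler = begin
      1# + largestPartTail 0 n
        ≈⟨ +-congˡ (trans (sym (*-identityˡ _)) (largestPartTail-sum 0 n)) ⟩
      1# + Σ< n (λ i → Π< (suc i) g * zQ ^ suc i)
        ≈⟨ +-cong (trans (sym (*-identityʳ _)) (*-congʳ (sym (*-identityʳ _))))
                  (Σ<-cong n (λ i _ → *-congʳ (trans (sym (*-identityˡ _)) (*-congʳ (sym (poch-0 (suc i))))))) ⟩
      1# * 1# * 1# + Σ< n (λ i → binomialCoefficient 0# (suc i) * zQ ^ suc i)
        ≈⟨ Σ<-front n (λ i → binomialCoefficient 0# i * zQ ^ i) ⟨
      binomialSeries 0# zQ
        ≈⟨ qBinomial 0# Ord-zQ ⟩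
      Π< n (λ r → 1# - 0# * (zQ * Q ^ r)) * Π< n (λ r → geo (zQ * Q ^ r))
        ≈⟨ *-cong (Π<-one n (λ r _ → 1-0* _)) (Π<-cong n (λ r _ → geo-cong (*-assoc z Q (Q ^ r)))) ⟩
      1# * Π< n h
        ≈⟨ *-identityˡ _ ⟩
      Π< n h ∎
      where
      1-0* : ∀ a → 1# - 0# * a ≈ 1#
      1-0* = solve 1 (λ a → con (+ 1) :- con (+ 0) :* a := con (+ 1)) refl
      poch-0 : ∀ i → poch 0# i ≈ 1#
      poch-0 i = Π<-one i (λ r _ → 1-0* _)

    -- Split off part 1 in `euler` and multiply by 1 - Q: the result is 1 - Q + zQ + T with T the
    -- nonempty partitions without ones. The correction zQ - Q is what 1 + T lacks.
    noOnesTerm : largestPartSum 0 1 n′ + (zQ - Q) ≈ (1# - Q) * Π< n h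
    noOnesTerm = begin
      largestPartSum 0 1 n′ + (zQ - Q)
        ≈⟨ +-congʳ (largestPartSum-tail 0 1 n′) ⟩
      1# + T + (zQ - Q)
        ≈⟨ solve 3 (λ T a Q → con (+ 1) :+ T :+ (a :- Q) := (con (+ 1) :- Q) :+ con (+ 1) :* (a :* con (+ 1) :+ T)) refl T zQ Q ⟩
      (1# - Q) + 1# * (zQ * 1# + T)
        ≈⟨ +-congˡ (*-congʳ (geo-inverse Ord-Q)) ⟨
      (1# - Q) + (1# - Q) * geo Q * (zQ * 1# + T)
        ≈⟨ +-congˡ (*-congʳ (*-congˡ (geo-cong (sym (*-identityʳ Q))))) ⟩
      (1# - Q) + (1# - Q) * g 0 * (zQ * 1# + T)
        ≈⟨ solve 3 (λ u g t → u :+ u :* g :* t := u :* (con (+ 1) :+ g :* t)) refl (1# - Q) (g 0) (zQ * 1# + T) ⟩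
      (1# - Q) * (1# + largestPartTail 0 n)
        ≈⟨ *-congˡ euler ⟩
      (1# - Q) * Π< n h ∎
      where
      T : Carrier
      T = largestPartTail 1 n′

    -- Partitions by their number of ones. As v = Q/z, the power of `v` carries both the size of the
    -- ones and their negative share of the crank.
    crankSeries : Carrier
    crankSeries = largestPartSum 0 1 n′ + (zQ - Q)
      + Σ< n (λ ω → v ^ suc ω * Π< n′ (λ i → geo (φ (suc ω) (suc (suc i)))))

    -- All terms share (1 - Q) · `Π< n h`; what remains is the q-binomial series with a = zQ and t =
    -- v. Since z v = Q, its numerators are 1 - Qʳ⁺², and with 1 - Q they give the full product,
    -- whose last factor is 1 because Qⁿ⁺¹ = 0.
    crankSeries-product :
      crankSeries ≈ Π< n (λ j → 1# - Q ^ suc j) * Π< n h * Π< n (λ j → geo (v * Q ^ j))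
    crankSeries-product = begin
      largestPartSum 0 1 n′ + (zQ - Q) + Σ< n (λ ω → v ^ suc ω * Π< n′ (λ i → geo (φ (suc ω) (suc (suc i)))))
        ≈⟨ +-cong noOnesTerm (Σ<-cong n (λ ω ω<n → trans (*-congˡ (onesTerm ω ω<n))
            (solve 4 (λ a u b H → a :* (u :* (b :* H)) := u :* H :* (b :* a)) refl (v ^ suc ω) (1# - Q) (binomialCoefficient zQ (suc ω)) H))) ⟩
      u * H + Σ< n (λ ω → u * H * (binomialCoefficient zQ (suc ω) * v ^ suc ω))
        ≈⟨ +-cong (sym (trans (*-congˡ (trans (*-identityʳ _) (*-identityʳ _))) (*-identityʳ _))) (Σ<-*ˡ n (u * H) _) ⟩
      u * H * (1# * 1# * 1#) + u * H * Σ< n (λ ω → binomialCoefficient zQ (suc ω) * v ^ suc ω)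
        ≈⟨ distribˡ _ _ _ ⟨
      u * H * (1# * 1# * 1# + Σ< n (λ ω → binomialCoefficient zQ (suc ω) * v ^ suc ω))
        ≈⟨ *-congˡ (Σ<-front n (λ i → binomialCoefficient zQ i * v ^ i)) ⟨
      u * H * binomialSeries zQ v
        ≈⟨ *-congˡ (qBinomial zQ Ord-v) ⟩
      u * H * (Π< n (λ r → 1# - zQ * (v * Q ^ r)) * V)
        ≈⟨ *-congˡ (*-congʳ (Π<-cong n (λ r _ → +-congˡ (-‿cong
            (solve 3 (λ z y t → z :* (z :* y :* (z :* y)) :* (z :* y :* y :* t) := z :* y :* (z :* y) :* (z :* y :* (z :* y) :* t)) refl z y (Q ^ r)))))) ⟩
      u * H * (Π< n (λ r → 1# - Q ^ suc (suc r)) * V)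
        ≈⟨ solve 4 (λ u H P V → u :* H :* (P :* V) := u :* P :* H :* V) refl u H (Π< n (λ r → 1# - Q ^ suc (suc r))) V ⟩
      u * Π< n (λ r → 1# - Q ^ suc (suc r)) * H * V
        ≈⟨ *-congʳ (*-congʳ (*-congʳ (+-congˡ (-‿cong (*-identityʳ Q))))) ⟨
      (1# - Q ^ 1) * Π< n (λ r → 1# - Q ^ suc (suc r)) * H * V
        ≈⟨ *-congʳ (*-congʳ (Π<-front n (λ r → 1# - Q ^ suc r))) ⟨
      Π< n (λ r → 1# - Q ^ suc r) * (1# - Q ^ suc n) * H * V
        ≈⟨ *-congʳ (*-congʳ (trans (*-congˡ (+-congˡ (-‿cong (Ord-vanish ℕ.≤-refl (Ord-^ (suc n) Ord-Q)))))
             (solve 1 (λ a → a :* (con (+ 1) :- con (+ 0)) := a) refl _))) ⟩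
      Π< n (λ j → 1# - Q ^ suc j) * H * V ∎
      where
      u H V : Carrier
      u = 1# - Q
      H = Π< n h
      V = Π< n (λ r → geo (v * Q ^ r))

    -- A regrouping: the crank numerators go to the odd non-overlined parts, forming `ρ`, and the
    -- overlined even parts go to the crank denominators, forming `Φ`.
    Pos-overpartitionSeries :
      Pos (Π< n (λ j → (1# + odd j) * geo (odd j) * (1# + Q ^ suc j)) * crankSeries)
    Pos-overpartitionSeries = Pos-≈ (begin
      Π< n (λ j → 1# + odd j) * Π< n ρ * Π< n Φ
        ≈⟨ *-cong (*-congˡ (Π<-* n _ _)) (trans (Π<-* n _ _) (*-congʳ (Π<-* n _ _))) ⟩
      A * (C * B) * (D * Π< n h * V)
        ≈⟨ solve 6 (λ A B C D H V → A :* (C :* B) :* (D :* H :* V) := A :* B :* D :* (C :* H :* V)) refl A B C D (Π< n h) V ⟩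
      A * B * D * (C * Π< n h * V)
        ≈⟨ *-cong (trans (Π<-* n _ _) (*-congʳ (Π<-* n _ _))) crankSeries-product ⟨
      Π< n (λ j → (1# + odd j) * geo (odd j) * (1# + Q ^ suc j)) * crankSeries ∎)
      (Pos-* (Pos-* (Pos-Π< n (λ j → Pos-+ Pos-1 (Pos-odd j))) Pos-gauss) (Pos-Π< n Pos-Φ))
      where
      A B C D V : Carrier
      A = Π< n (λ j → 1# + odd j)
      B = Π< n (λ j → geo (odd j))
      C = Π< n (λ j → 1# - Q ^ suc j)
      D = Π< n (λ j → 1# + Q ^ suc j)
      V = Π< n (λ j → geo (v * Q ^ j))

-- Parity of part sizes and the halved partition.

isEven : ℕ → Bool
isEven k = k ℕ.% 2 ℕ.≡ᵇ 0

bit : Bool → ℕ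
bit b = if b then 1 else 0

halved-even : ∀ k m b xs → isEven k ≡ true →
  halved k ((m , b) ∷ xs) ≡ replicate (m ℕ.∸ bit b) ℕ.⌊ k /2⌋ ++ halved (suc k) xs
halved-even k m b xs even rewrite even = ≡.refl

halved-odd : ∀ k m b xs → isEven k ≡ false → halved k ((m , b) ∷ xs) ≡ halved (suc k) xs
halved-odd k m b xs odd rewrite odd = ≡.refl

double : ℕ → ℕ
double zero    = zero
double (suc j) = suc (suc (double j))

double-even : ∀ j → isEven (double j) ≡ true
double-even zero    = ≡.refl
double-even (suc j) = double-even j

double-odd : ∀ j → isEven (suc (double j)) ≡ false
double-odd zero    = ≡.refl
double-odd (suc j) = double-odd j

⌊double/2⌋ : ∀ j → ℕ.⌊ double j /2⌋ ≡ j
⌊double/2⌋ zero    = ≡.refl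
⌊double/2⌋ (suc j) = ≡.cong suc (⌊double/2⌋ j)

m+m≡double : ∀ m → m ℕ.+ m ≡ double m
m+m≡double zero    = ≡.refl
m+m≡double (suc m) = ≡.cong suc (≡.trans (ℕ.+-suc m m) (≡.cong suc (m+m≡double m)))

double-⌊/2⌋ : ∀ k → isEven k ≡ true → double ℕ.⌊ k /2⌋ ≡ k
double-⌊/2⌋ zero          _    = ≡.refl
double-⌊/2⌋ (suc (suc k)) even = ≡.cong (suc ∘ suc) (double-⌊/2⌋ k even)

largest : List ℕ → ℕ
largest = foldr ℕ._⊔_ 0

largest-replicate : ∀ i j r → largest (replicate (suc i) j ++ r) ≡ j ℕ.⊔ largest r
largest-replicate zero    j r = ≡.refl
largest-replicate (suc i) j r = ≡.trans (≡.cong (j ℕ.⊔_) (largest-replicate i j r))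
  (≡.trans (≡.sym (ℕ.⊔-assoc j j (largest r))) (≡.cong (ℕ._⊔ largest r) (ℕ.⊔-idem j)))

-- Generating functions as sums over codes.

module Enumeration {c ℓ : Level} (R : CommutativeRing c ℓ) where

  open CommutativeRing R hiding (zero)
  open import Algebra.Properties.CommutativeSemiring.Exp commutativeSemiring
  open import Relation.Binary.Reasoning.Setoid setoid
  open IntegerCoefficients R using (solve; _:=_; _:+_; _:*_; _:-_; con)
  open FiniteSums R
  open QSeries R

  ΣL : ∀ {a} {A : Set a} → List A → (A → Carrier) → Carrier
  ΣL xs f = foldr (λ x acc → f x + acc) 0# xs

  module _ {a} {A : Set a} where

    ΣL-cong : ∀ (xs : List A) {f g} → (∀ x → f x ≈ g x) → ΣL xs f ≈ ΣL xs g
    ΣL-cong []       p = refl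
    ΣL-cong (x ∷ xs) p = +-cong (p x) (ΣL-cong xs p)

    ΣL-zero : ∀ (xs : List A) → ΣL xs (λ _ → 0#) ≈ 0#
    ΣL-zero []       = refl
    ΣL-zero (x ∷ xs) = trans (+-identityˡ _) (ΣL-zero xs)

    ΣL-++ : ∀ (xs ys : List A) f → ΣL (xs ++ ys) f ≈ ΣL xs f + ΣL ys f
    ΣL-++ []       ys f = sym (+-identityˡ _)
    ΣL-++ (x ∷ xs) ys f = trans (+-congˡ (ΣL-++ xs ys f)) (sym (+-assoc _ _ _))

    ΣL-map : ∀ {b} {B : Set b} (xs : List B) (t : B → A) f → ΣL (map t xs) f ≈ ΣL xs (f ∘ t)
    ΣL-map []       t f = refl
    ΣL-map (x ∷ xs) t f = +-congˡ (ΣL-map xs t f)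

    ΣL-concatMap : ∀ {b} {B : Set b} (xs : List B) (t : B → List A) f →
      ΣL (concatMap t xs) f ≈ ΣL xs (λ x → ΣL (t x) f)
    ΣL-concatMap []       t f = refl
    ΣL-concatMap (x ∷ xs) t f = trans (ΣL-++ (t x) (concatMap t xs) f) (+-congˡ (ΣL-concatMap xs t f))

    ΣL-applyUpTo : ∀ k (t : ℕ → A) f → ΣL (applyUpTo t k) f ≈ Σ< k (f ∘ t)
    ΣL-applyUpTo zero    t f = refl
    ΣL-applyUpTo (suc k) t f = trans (+-congˡ (ΣL-applyUpTo k (t ∘ suc) f)) (sym (Σ<-front k (f ∘ t)))

    ΣL-+ : ∀ (xs : List A) f g → ΣL xs (λ x → f x + g x) ≈ ΣL xs f + ΣL xs g
    ΣL-+ []       f g = sym (+-identityˡ _)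
    ΣL-+ (x ∷ xs) f g = trans (+-congˡ (ΣL-+ xs f g))
      (solve 4 (λ a b s t → a :+ b :+ (s :+ t) := a :+ s :+ (b :+ t)) refl (f x) (g x) (ΣL xs f) (ΣL xs g))

    ΣL-*ˡ : ∀ (xs : List A) a f → ΣL xs (λ x → a * f x) ≈ a * ΣL xs f
    ΣL-*ˡ []       a f = sym (zeroʳ a)
    ΣL-*ˡ (x ∷ xs) a f = trans (+-congˡ (ΣL-*ˡ xs a f)) (sym (distribˡ _ _ _))

  ΣL-× : ∀ {a b} {A : Set a} {B : Set b} (xs : List A) (ys : List B) f →
    ΣL (cartesianProduct xs ys) f ≈ ΣL xs (λ x → ΣL ys (λ y → f (x , y)))
  ΣL-× []       ys f = refl
  ΣL-× (x ∷ xs) ys f = trans (ΣL-++ (map (x ,_) ys) (cartesianProduct xs ys) f) (+-cong (ΣL-map ys (x ,_) f) (ΣL-× xs ys f))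

  Πfrom : (ℕ → Carrier) → ℕ → ℕ → Carrier
  Πfrom f k zero    = 1#
  Πfrom f k (suc l) = f k * Πfrom f (suc k) l

  Πfrom-one : ∀ f k l → (∀ i → k ℕ.≤ i → f i ≈ 1#) → Πfrom f k l ≈ 1#
  Πfrom-one f k zero    p = refl
  Πfrom-one f k (suc l) p = trans (*-cong (p k ℕ.≤-refl) (Πfrom-one f (suc k) l (λ i k<i → p i (ℕ.<⇒≤ k<i)))) (*-identityˡ _)

  Πfrom-extend : ∀ f k l d → (∀ i → k ℕ.+ l ℕ.≤ i → f i ≈ 1#) → Πfrom f k (l ℕ.+ d) ≈ Πfrom f k l
  Πfrom-extend f k zero    d p = Πfrom-one f k d (λ i k≤i → p i (≡.subst (ℕ._≤ i) (≡.sym (ℕ.+-identityʳ k)) k≤i))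
  Πfrom-extend f k (suc l) d p = *-congˡ (Πfrom-extend f (suc k) l d (λ i k+l<i → p i (≡.subst (ℕ._≤ i) (≡.sym (ℕ.+-suc k l)) k+l<i)))

  Πfrom-double : ∀ f k → ∀ L → Πfrom f (suc (double k)) (double L) ≈ Π< L (λ i → f (suc (double (k ℕ.+ i))) * f (double (suc (k ℕ.+ i))))
  Πfrom-double f k zero = refl
  Πfrom-double f k (suc L) = begin
    f (suc (double k)) * (f (double (suc k)) * Πfrom f (suc (double (suc k))) (double L))
      ≈⟨ *-assoc _ _ _ ⟨
    F k * Πfrom f (suc (double (suc k))) (double L)
      ≈⟨ *-cong (reflexive (≡.cong F (≡.sym (ℕ.+-identityʳ k))))
                (trans (Πfrom-double f (suc k) L) (Π<-cong L (λ i _ → reflexive (≡.cong F (≡.sym (ℕ.+-suc k i)))))) ⟩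
    F (k ℕ.+ 0) * Π< L (λ i → F (k ℕ.+ suc i))
      ≈⟨ Π<-front L (λ i → F (k ℕ.+ i)) ⟨
    Π< (suc L) (λ i → F (k ℕ.+ i)) ∎
    where
    F : ℕ → Carrier
    F i = f (suc (double i)) * f (double (suc i))

  module Counting (z y : Carrier) (l : ℕ) (y-nilpotent : y ^ suc (suc (suc l)) ≈ 0#) where

    open Truncated z y (suc l) y-nilpotent

    -- All weights are included. The bound `n` on multiplicities costs nothing, as higher ones would
    -- contribute elements of order above n.
    wfSum : ℕ → (OPData → Carrier) → Carrier
    wfSum k f = ΣL (codes n k) (λ xs → if wellFormed xs then f xs else 0#)

    if-cong : ∀ b {x x′ : Carrier} → x ≈ x′ → (if b then x else 0#) ≈ (if b then x′ else 0#)
    if-cong true  e = e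
    if-cong false e = refl

    if-*ˡ : ∀ b a {x} → (if b then a * x else 0#) ≈ a * (if b then x else 0#)
    if-*ˡ true  a = refl
    if-*ˡ false a = sym (zeroʳ a)

    if-+ : ∀ b {x x′ : Carrier} → (if b then x + x′ else 0#) ≈ (if b then x else 0#) + (if b then x′ else 0#)
    if-+ true  = refl
    if-+ false = sym (+-identityˡ _)

    wfSum-cong : ∀ k {f f′} → (∀ xs → f xs ≈ f′ xs) → wfSum k f ≈ wfSum k f′
    wfSum-cong k p = ΣL-cong (codes n k) (λ xs → if-cong (wellFormed xs) (p xs))

    wfSum-*ˡ : ∀ k a f → wfSum k (λ xs → a * f xs) ≈ a * wfSum k f
    wfSum-*ˡ k a f = trans (ΣL-cong (codes n k) (λ xs → if-*ˡ (wellFormed xs) a)) (ΣL-*ˡ (codes n k) a _)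

    wfSum-+ : ∀ k f f′ → wfSum k (λ xs → f xs + f′ xs) ≈ wfSum k f + wfSum k f′
    wfSum-+ k f f′ = trans (ΣL-cong (codes n k) (λ xs → if-+ (wellFormed xs))) (ΣL-+ (codes n k) _ _)

    wfSum-0 : ∀ f → wfSum 0 f ≈ f []
    wfSum-0 f = +-identityʳ _

    -- A size contributes u i with i non-overlined copies, and an extra factor a with one more overlined copy.
    wfSum-suc : ∀ k f a u →
      (∀ m → wfSum k (λ xs → f ((m , false) ∷ xs)) ≈ u m) →
      (∀ i → wfSum k (λ xs → f ((suc i , true) ∷ xs)) ≈ a * u i) →
      a * u n ≈ 0# →
      wfSum (suc k) f ≈ (1# + a) * Σ< (suc n) u
    wfSum-suc k f a u plain overlined vanishing = begin
      wfSum (suc k) f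
        ≈⟨ ΣL-concatMap entries (λ x → map (x ∷_) (codes n k)) F ⟩
      ΣL entries (λ x → ΣL (map (x ∷_) (codes n k)) F)
        ≈⟨ ΣL-cong entries (λ x → ΣL-map (codes n k) (x ∷_) F) ⟩
      ΣL entries (λ x → ΣL (codes n k) (λ xs → F (x ∷ xs)))
        ≈⟨ ΣL-× (upTo (suc n)) (true ∷ false ∷ []) _ ⟩
      ΣL (upTo (suc n)) (λ m → T m + (P m + 0#))
        ≈⟨ ΣL-cong (upTo (suc n)) (λ m → +-congˡ (+-identityʳ _)) ⟩
      ΣL (upTo (suc n)) (λ m → T m + P m)
        ≈⟨ ΣL-+ (upTo (suc n)) T P ⟩
      ΣL (upTo (suc n)) T + ΣL (upTo (suc n)) P
        ≈⟨ +-cong (ΣL-applyUpTo (suc n) id T) (ΣL-applyUpTo (suc n) id P) ⟩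
      Σ< (suc n) T + Σ< (suc n) P
        ≈⟨ +-cong (Σ<-front n T) (Σ<-cong (suc n) (λ m _ → plain m)) ⟩
      (T 0 + Σ< n (T ∘ suc)) + Σ< (suc n) u
        -- A size of multiplicity 0 cannot be overlined, so `T 0` is a sum of zeros.
        ≈⟨ +-congʳ (+-cong (ΣL-zero (codes n k)) (trans (Σ<-cong n (λ i _ → overlined i)) (Σ<-*ˡ n a u))) ⟩
      (0# + a * Σ< n u) + Σ< (suc n) u
        -- An overlined size has at most n - 1 further copies; the missing term `a * u n` is zero
        -- and is added to complete the sum.
        ≈⟨ +-congʳ (trans (+-congʳ (sym vanishing)) (trans (+-comm _ _) (sym (distribˡ _ _ _)))) ⟩
      a * Σ< (suc n) u + Σ< (suc n) u
        ≈⟨ solve 2 (λ a s → a :* s :+ s := (con (+ 1) :+ a) :* s) refl a (Σ< (suc n) u) ⟩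
      (1# + a) * Σ< (suc n) u ∎
      where
      entries : List (ℕ × Bool)
      entries = cartesianProduct (upTo (suc n)) (true ∷ false ∷ [])
      F : OPData → Carrier
      F xs = if wellFormed xs then f xs else 0#
      T P : ℕ → Carrier
      T m = ΣL (codes n k) (λ xs → F ((m , true) ∷ xs))
      P m = ΣL (codes n k) (λ xs → F ((m , false) ∷ xs))

    -- The factor of size k coming from overlined parts and odd parts.
    pre : ℕ → Carrier
    pre k = if isEven k then 1# + q ^ k else (1# + q ^ k) * geo (q ^ k)

    Ord-q^ : ∀ k → Ord (suc k) (q ^ suc k)
    Ord-q^ k = Ord-^ (suc k) Ord-q

    -- `ψ p` is the weight of one non-overlined part 2p. The choice `φ ω` marks with z the halved
    -- parts larger than ω, and the choice 0 forces the halved partition to be empty.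
    entryValue : (ℕ → Carrier) → ℕ → ℕ → Bool → Carrier
    entryValue ψ k m b =
      if isEven k then (if b then q ^ k else 1#) * ψ ℕ.⌊ k /2⌋ ^ (m ℕ.∸ bit b) else q ^ (k ℕ.* m)

    value : (ℕ → Carrier) → ℕ → OPData → Carrier
    value ψ k []             = 1#
    value ψ k ((m , b) ∷ xs) = entryValue ψ k m b * value ψ (suc k) xs

    evenFactor : (ℕ → Carrier) → ℕ → Carrier
    evenFactor ψ k = if isEven k then geo (ψ ℕ.⌊ k /2⌋) else 1#

    -- The value is multiplicative over sizes, so each size gives its own geometric series;
    -- divisibility of `ψ` by y lets the series end at multiplicity n.
    wfSum-value : ∀ ψ → (∀ p → Ord 1 (ψ (suc p))) → ∀ L k →
      wfSum L (value ψ (suc k)) ≈ Πfrom pre (suc k) L * Πfrom (evenFactor ψ) (suc k) L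
    wfSum-value ψ o zero k = trans (wfSum-0 (value ψ (suc k))) (sym (*-identityˡ _))
    wfSum-value ψ o (suc L) k with isEven (suc k) in even
    ... | true = begin
      wfSum (suc L) (value ψ (suc k))
        ≈⟨ wfSum-suc L _ (q ^ suc k) (λ i → x ^ i * rest)
             (λ m → trans (wfSum-cong L (λ xs → *-congʳ (trans (entry m false) (*-identityˡ _)))) (wfSum-*ˡ L _ _))
             (λ i → trans (wfSum-cong L (λ xs → trans (*-congʳ (entry (suc i) true)) (*-assoc _ _ _)))
                          (trans (wfSum-*ˡ L _ _) (*-congˡ (wfSum-*ˡ L _ _))))
             (trans (sym (*-assoc _ _ _)) (trans (*-congʳ (Ord-vanish (s≤s (ℕ.m≤n+m n k)) (Ord-* (Ord-q^ k) (Ord-^ n Ord-x)))) (zeroˡ _))) ⟩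
      (1# + q ^ suc k) * Σ< (suc n) (λ i → x ^ i * rest)
        ≈⟨ *-congˡ (trans (Σ<-cong (suc n) (λ i _ → *-comm _ _)) (Σ<-*ˡ (suc n) rest (x ^_))) ⟩
      (1# + q ^ suc k) * (rest * geo x)
        ≈⟨ *-congˡ (*-congʳ (wfSum-value ψ o L (suc k))) ⟩
      (1# + q ^ suc k) * (Πfrom pre (suc (suc k)) L * Πfrom (evenFactor ψ) (suc (suc k)) L * geo x)
        ≈⟨ solve 4 (λ a b d e → a :* (b :* d :* e) := a :* b :* (e :* d)) refl _ _ _ _ ⟩
      (1# + q ^ suc k) * Πfrom pre (suc (suc k)) L * (geo x * Πfrom (evenFactor ψ) (suc (suc k)) L) ∎
      where
      x rest : Carrier
      x = ψ ℕ.⌊ suc k /2⌋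
      rest = wfSum L (value ψ (suc (suc k)))
      entry : ∀ m b → entryValue ψ (suc k) m b ≈ (if b then q ^ suc k else 1#) * x ^ (m ℕ.∸ bit b)
      entry m b rewrite even = refl
      Ord-x : Ord 1 x
      Ord-x = half k even
        where
        half : ∀ k → isEven (suc k) ≡ true → Ord 1 (ψ ℕ.⌊ suc k /2⌋)
        half (suc k) _ = o ℕ.⌊ k /2⌋
    ... | false = begin
      wfSum (suc L) (value ψ (suc k))
        ≈⟨ wfSum-suc L _ (q ^ suc k) (λ i → (q ^ suc k) ^ i * rest)
             (λ m → trans (wfSum-cong L (λ xs → *-congʳ (entry m false))) (wfSum-*ˡ L _ _))
             (λ i → trans (wfSum-cong L (λ xs → trans (*-congʳ (entry (suc i) true)) (*-assoc _ _ _)))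
                          (trans (wfSum-*ˡ L _ _) (*-congˡ (wfSum-*ˡ L _ _))))
             (trans (sym (*-assoc _ _ _)) (trans (*-congʳ (Ord-vanish (s≤s (ℕ.m≤n+m n k)) (Ord-* (Ord-q^ k) (Ord-^ n (Ord-*ʳ (q ^ k) Ord-q))))) (zeroˡ _))) ⟩
      (1# + q ^ suc k) * Σ< (suc n) (λ i → (q ^ suc k) ^ i * rest)
        ≈⟨ *-congˡ (trans (Σ<-cong (suc n) (λ i _ → *-comm _ _)) (Σ<-*ˡ (suc n) rest ((q ^ suc k) ^_))) ⟩
      (1# + q ^ suc k) * (rest * geo (q ^ suc k))
        ≈⟨ *-congˡ (*-congʳ (wfSum-value ψ o L (suc k))) ⟩
      (1# + q ^ suc k) * (Πfrom pre (suc (suc k)) L * Πfrom (evenFactor ψ) (suc (suc k)) L * geo (q ^ suc k))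
        ≈⟨ solve 4 (λ a b d e → a :* (b :* d :* e) := a :* e :* b :* (con (+ 1) :* d)) refl _ _ _ _ ⟩
      (1# + q ^ suc k) * geo (q ^ suc k) * Πfrom pre (suc (suc k)) L * (1# * Πfrom (evenFactor ψ) (suc (suc k)) L) ∎
      where
      rest : Carrier
      rest = wfSum L (value ψ (suc (suc k)))
      entry : ∀ m b → entryValue ψ (suc k) m b ≈ (q ^ suc k) ^ m
      entry m b rewrite even = sym (^-assocʳ q (suc k) m)

    -- The largest part is not multiplicative over sizes; `c` holds the maximum of the sizes already
    -- passed.
    largestValue : ℕ → ℕ → OPData → Carrier
    largestValue c k xs = q ^ weight k xs * z ^ (c ℕ.⊔ largest (halved k xs))

    largestSum : ℕ → ℕ → ℕ → Carrier
    largestSum c k zero    = z ^ c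
    largestSum c k (suc L) =
      if isEven k then largestSum c (suc k) L + q ^ k * geo (q ^ k) * largestSum ℕ.⌊ k /2⌋ (suc k) L
      else largestSum c (suc k) L

    -- Sizes are visited in increasing order; the invariant on `c` says that a newly present halved
    -- part replaces the running maximum.
    wfSum-largest : ∀ L k c → c ℕ.≤ ℕ.⌊ suc k /2⌋ →
      wfSum L (largestValue c (suc k)) ≈ Πfrom pre (suc k) L * largestSum c (suc k) L
    wfSum-largest zero k c c≤j = trans (wfSum-0 (largestValue c (suc k)))
      (*-congˡ (^-congʳ z (ℕ.⊔-identityʳ c)))
    wfSum-largest (suc L) k c c≤j with isEven (suc k) in even
    ... | true = begin
      wfSum (suc L) (largestValue c (suc k))
        ≈⟨ wfSum-suc L _ x (λ i → x ^ i * rest (c′ i))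
             (λ m → trans (wfSum-cong L (λ xs → entry m false xs)) (wfSum-*ˡ L _ _))
             (λ i → trans (wfSum-cong L (λ xs → entry (suc i) true xs)) (trans (wfSum-*ˡ L _ _) (*-assoc _ _ _)))
             (trans (sym (*-assoc _ _ _)) (trans (*-congʳ x^-vanish) (zeroˡ _))) ⟩
      (1# + x) * Σ< (suc n) (λ i → x ^ i * rest (c′ i))
        ≈⟨ *-congˡ (Σ<-front n _) ⟩
      (1# + x) * (1# * rest c + Σ< n (λ i → x * x ^ i * rest j))
        ≈⟨ *-congˡ (+-cong (*-identityˡ _) (trans (Σ<-cong n (λ i _ → solve 3 (λ x t r → x :* t :* r := x :* r :* t) refl x (x ^ i) (rest j)))
                                                  (Σ<-*ˡ n (x * rest j) (x ^_)))) ⟩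
      (1# + x) * (rest c + x * rest j * Σ< n (x ^_))
        -- One copy is already split off, so the sum is one term short of `geo x`; the missing term
        -- contains x · xⁿ = 0.
        ≈⟨ *-congˡ (trans (sym (+-identityʳ _)) (trans (+-congˡ (sym (trans (*-congʳ x^-vanish) (zeroˡ (rest j)))))
             (solve 5 (λ r x s g t → r :+ x :* s :* g :+ x :* t :* s := r :+ x :* (g :+ t) :* s) refl (rest c) x (rest j) (Σ< n (x ^_)) (x ^ n)))) ⟩
      (1# + x) * (rest c + x * geo x * rest j)
        ≈⟨ *-congˡ (+-cong (wfSum-largest L (suc k) c (ℕ.≤-trans c≤j j≤j′)) (*-congˡ (wfSum-largest L (suc k) j j≤j′))) ⟩
      (1# + x) * (P * largestSum c (suc (suc k)) L + x * geo x * (P * largestSum j (suc (suc k)) L))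
        ≈⟨ solve 5 (λ a P s b t → a :* (P :* s :+ b :* (P :* t)) := a :* P :* (s :+ b :* t)) refl (1# + x) P (largestSum c (suc (suc k)) L) (x * geo x) (largestSum j (suc (suc k)) L) ⟩
      (1# + x) * P * (largestSum c (suc (suc k)) L + x * geo x * largestSum j (suc (suc k)) L) ∎
      where
      x P : Carrier
      x = q ^ suc k
      P = Πfrom pre (suc (suc k)) L
      j : ℕ
      j = ℕ.⌊ suc k /2⌋
      j≤j′ : j ℕ.≤ ℕ.⌊ suc (suc k) /2⌋
      j≤j′ = ℕ.⌊n/2⌋-mono (ℕ.n≤1+n (suc k))
      rest : ℕ → Carrier
      rest c = wfSum L (largestValue c (suc (suc k)))
      c′ : ℕ → ℕ
      c′ zero    = c
      c′ (suc _) = j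
      x^-vanish : x * x ^ n ≈ 0#
      x^-vanish = Ord-vanish (s≤s (ℕ.m≤n+m n k)) (Ord-* (Ord-q^ k) (Ord-^ n (Ord-*ʳ (q ^ k) Ord-q)))
      c⊔largest : ∀ i r → c ℕ.⊔ largest (replicate i j ++ r) ≡ c′ i ℕ.⊔ largest r
      c⊔largest zero    r = ≡.refl
      c⊔largest (suc i) r = ≡.trans (≡.cong (c ℕ.⊔_) (largest-replicate i j r))
        (≡.trans (≡.sym (ℕ.⊔-assoc c j (largest r))) (≡.cong (ℕ._⊔ largest r) (ℕ.m≤n⇒m⊔n≡n c≤j)))
      entry : ∀ m b xs → largestValue c (suc k) ((m , b) ∷ xs) ≈ x ^ m * largestValue (c′ (m ℕ.∸ bit b)) (suc (suc k)) xs
      entry m b xs = begin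
        q ^ (suc k ℕ.* m ℕ.+ weight (suc (suc k)) xs) * z ^ (c ℕ.⊔ largest (halved (suc k) ((m , b) ∷ xs)))
          ≈⟨ *-cong (trans (^-homo-* q (suc k ℕ.* m) _) (*-congʳ (sym (^-assocʳ q (suc k) m))))
                    (^-congʳ z (≡.trans (≡.cong (λ r → c ℕ.⊔ largest r) (halved-even (suc k) m b xs even)) (c⊔largest (m ℕ.∸ bit b) _))) ⟩
        x ^ m * q ^ weight (suc (suc k)) xs * z ^ (c′ (m ℕ.∸ bit b) ℕ.⊔ largest (halved (suc (suc k)) xs))
          ≈⟨ *-assoc _ _ _ ⟩
        x ^ m * largestValue (c′ (m ℕ.∸ bit b)) (suc (suc k)) xs ∎
    ... | false = begin
      wfSum (suc L) (largestValue c (suc k))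
        ≈⟨ wfSum-suc L _ x (λ i → x ^ i * rest)
             (λ m → trans (wfSum-cong L (λ xs → entry m false xs)) (wfSum-*ˡ L _ _))
             (λ i → trans (wfSum-cong L (λ xs → entry (suc i) true xs)) (trans (wfSum-*ˡ L _ _) (*-assoc _ _ _)))
             (trans (sym (*-assoc _ _ _)) (trans (*-congʳ (Ord-vanish (s≤s (ℕ.m≤n+m n k)) (Ord-* (Ord-q^ k) (Ord-^ n (Ord-*ʳ (q ^ k) Ord-q))))) (zeroˡ _))) ⟩
      (1# + x) * Σ< (suc n) (λ i → x ^ i * rest)
        ≈⟨ *-congˡ (trans (Σ<-cong (suc n) (λ i _ → *-comm _ _)) (Σ<-*ˡ (suc n) rest (x ^_))) ⟩
      (1# + x) * (rest * geo x)
        ≈⟨ *-congˡ (*-congʳ (wfSum-largest L (suc k) c (ℕ.≤-trans c≤j (ℕ.⌊n/2⌋-mono (ℕ.n≤1+n (suc k)))))) ⟩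
      (1# + x) * (Πfrom pre (suc (suc k)) L * largestSum c (suc (suc k)) L * geo x)
        ≈⟨ solve 4 (λ a b d e → a :* (b :* d :* e) := a :* e :* b :* d) refl _ _ _ _ ⟩
      (1# + x) * geo x * Πfrom pre (suc (suc k)) L * largestSum c (suc (suc k)) L ∎
      where
      x rest : Carrier
      x = q ^ suc k
      rest = wfSum L (largestValue c (suc (suc k)))
      entry : ∀ m b xs → largestValue c (suc k) ((m , b) ∷ xs) ≈ x ^ m * largestValue c (suc (suc k)) xs
      entry m b xs = trans
        (*-cong (trans (^-homo-* q (suc k ℕ.* m) _) (*-congʳ (sym (^-assocʳ q (suc k) m))))
                (^-congʳ z (≡.cong (λ r → c ℕ.⊔ largest r) (halved-odd (suc k) m b xs even))))
        (*-assoc _ _ _)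

    -- Sizes beyond n contribute nothing, so every product may be extended to an even number of sizes.

    q^double : ∀ j → q ^ double j ≈ Q ^ j
    q^double zero    = refl
    q^double (suc j) = trans (sym (*-assoc _ _ _)) (*-congˡ (q^double j))

    q^-vanish : ∀ {k} → n ℕ.< k → q ^ k ≈ 0#
    q^-vanish {k} n<k = Ord-vanish n<k (Ord-^ k Ord-q)

    geo-vanish : ∀ {x} → x ≈ 0# → geo x ≈ 1#
    geo-vanish {x} e = begin
      geo x              ≈⟨ geo-cong e ⟩
      geo 0#             ≈⟨ solve 1 (λ a → a := (con (+ 1) :- con (+ 0)) :* a) refl (geo 0#) ⟩
      (1# - 0#) * geo 0# ≈⟨ geo-inverse Ord-0 ⟩
      1#                 ∎

    pre-vanish : ∀ k → n ℕ.< k → pre k ≈ 1#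
    pre-vanish k n<k with isEven k
    ... | true  = trans (+-congˡ (q^-vanish n<k)) (+-identityʳ _)
    ... | false = trans (*-cong (trans (+-congˡ (q^-vanish n<k)) (+-identityʳ _)) (geo-vanish (q^-vanish n<k))) (*-identityˡ _)

    evenFactor-vanish : ∀ ω k → n ℕ.< k → evenFactor (φ ω) k ≈ 1#
    evenFactor-vanish ω k n<k with isEven k in even
    ... | false = refl
    ... | true  = geo-vanish φ-vanish
      where
      Q^-vanish : Q ^ ℕ.⌊ k /2⌋ ≈ 0#
      Q^-vanish = trans (sym (q^double ℕ.⌊ k /2⌋)) (trans (^-congʳ q (double-⌊/2⌋ k even)) (q^-vanish n<k))
      φ-vanish : φ ω ℕ.⌊ k /2⌋ ≈ 0#
      φ-vanish with ω ℕ.<ᵇ ℕ.⌊ k /2⌋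
      ... | true  = trans (*-congˡ Q^-vanish) (zeroʳ z)
      ... | false = Q^-vanish

    largestSum-vanish : ∀ c k L → n ℕ.< k → largestSum c k L ≈ z ^ c
    largestSum-vanish c k zero    n<k = refl
    largestSum-vanish c k (suc L) n<k with isEven k
    ... | true  = trans (+-cong (largestSum-vanish c (suc k) L (ℕ.m<n⇒m<1+n n<k))
                                (trans (*-congʳ (trans (*-congʳ (q^-vanish n<k)) (zeroˡ _))) (zeroˡ _))) (+-identityʳ _)
    ... | false = largestSum-vanish c (suc k) L (ℕ.m<n⇒m<1+n n<k)

    largestSum-extend : ∀ c k L d → n ℕ.< k ℕ.+ L → largestSum c k (L ℕ.+ d) ≈ largestSum c k L
    largestSum-extend c k zero    d n<k = largestSum-vanish c k d (≡.subst (n ℕ.<_) (ℕ.+-identityʳ k) n<k)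
    largestSum-extend c k (suc L) d n<k with isEven k
    ... | true  = +-cong (largestSum-extend c (suc k) L d (≡.subst (n ℕ.<_) (ℕ.+-suc k L) n<k))
                         (*-congˡ (largestSum-extend ℕ.⌊ k /2⌋ (suc k) L d (≡.subst (n ℕ.<_) (ℕ.+-suc k L) n<k)))
    ... | false = largestSum-extend c (suc k) L d (≡.subst (n ℕ.<_) (ℕ.+-suc k L) n<k)

    largestSum-double : ∀ c j L → largestSum c (suc (double j)) (double L) ≈ largestPartSum c j L
    largestSum-double c j zero    = refl
    largestSum-double c j (suc L) rewrite double-odd j | double-even j | ⌊double/2⌋ j =
      +-cong (largestSum-double c (suc j) L)
             (*-cong (*-cong (q^double (suc j)) (geo-cong (q^double (suc j)))) (largestSum-double (suc j) (suc j) L))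

    evenFactor-double : ∀ ψ i → evenFactor ψ (suc (double i)) * evenFactor ψ (double (suc i)) ≈ geo (ψ (suc i))
    evenFactor-double ψ i rewrite double-odd i | double-even i | ⌊double/2⌋ i = *-identityˡ _

    pre-double : ∀ i → pre (suc (double i)) * pre (double (suc i)) ≈ (1# + odd i) * geo (odd i) * (1# + Q ^ suc i)
    pre-double i rewrite double-odd i | double-even i =
      *-cong (*-cong (+-congˡ (*-congˡ (q^double i))) (geo-cong (*-congˡ (q^double i)))) (+-congˡ (q^double (suc i)))

    -- Sizes 3, ..., n number l; with l + 2 trivial sizes more they form l + 1 pairs of an odd and
    -- an even size, one for each halved part 2, ..., n.
    l+[2+l]≡double : l ℕ.+ suc (suc l) ≡ double (suc l)
    l+[2+l]≡double = ≡.trans (ℕ.+-suc l (suc l)) (≡.cong suc (≡.trans (ℕ.+-suc l l) (≡.cong suc (m+m≡double l))))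

    evenProduct : ∀ ω → Πfrom (evenFactor (φ ω)) 3 l ≈ Π< (suc l) (λ i → geo (φ ω (suc (suc i))))
    evenProduct ω = begin
      Πfrom (evenFactor (φ ω)) 3 l                      ≈⟨ Πfrom-extend (evenFactor (φ ω)) 3 l (suc (suc l)) (λ i → evenFactor-vanish ω i) ⟨
      Πfrom (evenFactor (φ ω)) 3 (l ℕ.+ suc (suc l))    ≡⟨ ≡.cong (Πfrom (evenFactor (φ ω)) 3) l+[2+l]≡double ⟩
      Πfrom (evenFactor (φ ω)) 3 (double (suc l))       ≈⟨ Πfrom-double (evenFactor (φ ω)) 1 (suc l) ⟩
      Π< (suc l) (λ i → evenFactor (φ ω) (suc (double (suc i))) * evenFactor (φ ω) (double (suc (suc i))))
        ≈⟨ Π<-cong (suc l) (λ i _ → evenFactor-double (φ ω) (suc i)) ⟩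
      Π< (suc l) (λ i → geo (φ ω (suc (suc i))))        ∎

    largestSum-all : largestSum 0 3 l ≈ largestPartSum 0 1 (suc l)
    largestSum-all = begin
      largestSum 0 3 l                     ≈⟨ largestSum-extend 0 3 l (suc (suc l)) ℕ.≤-refl ⟨
      largestSum 0 3 (l ℕ.+ suc (suc l))   ≡⟨ ≡.cong (largestSum 0 3) l+[2+l]≡double ⟩
      largestSum 0 3 (double (suc l))      ≈⟨ largestSum-double 0 1 (suc l) ⟩
      largestPartSum 0 1 (suc l)           ∎

    preProduct : Πfrom pre 1 n ≈ Π< n (λ j → (1# + odd j) * geo (odd j) * (1# + Q ^ suc j))
    preProduct = begin
      Πfrom pre 1 n            ≈⟨ Πfrom-extend pre 1 n n pre-vanish ⟨
      Πfrom pre 1 (n ℕ.+ n)    ≡⟨ ≡.cong (Πfrom pre 1) (m+m≡double n) ⟩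
      Πfrom pre 1 (double n)   ≈⟨ Πfrom-double pre 0 n ⟩
      Π< n (λ i → pre (suc (double i)) * pre (double (suc i))) ≈⟨ Π<-cong n (λ i _ → pre-double i) ⟩
      Π< n (λ j → (1# + odd j) * geo (odd j) * (1# + Q ^ suc j)) ∎

    -- Correction for the halved partition consisting of the single part 1.
    κ : ℕ → Carrier
    κ zero    = zQ - Q
    κ (suc _) = 0#

    -- Weight of the sizes from 3 on, given the number of non-overlined 2's, which are the ones of
    -- the halved partition. The `κ` summand survives only for exactly one such 2 and no other even
    -- non-overlined part.
    term : ℕ → OPData → Carrier
    term zero    xs = largestValue 0 3 xs
    term (suc ω) xs = v ^ suc ω * value (φ (suc ω)) 3 xs + κ ω * value (λ _ → 0#) 3 xs

    -- Sizes 1 and 2 are taken off first because the weight of every later part depends on the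
    -- number of ones. The values on shorter lists are those for which `leafCoefficient` also holds
    -- there.
    leafTail leaf : OPData → Carrier
    leafTail []             = 1#
    leafTail ((m , b) ∷ xs) = (if b then q ^ 2 else 1#) * term (m ℕ.∸ bit b) xs
    leaf []             = 0#
    leaf ((m , _) ∷ xs) = q ^ m * leafTail xs

    Ord-φ : ∀ ω p → Ord 1 (φ ω (suc p))
    Ord-φ ω p with ω ℕ.<ᵇ suc p
    ... | true  = Ord-*ˡ z (Ord-Q^ p)
    ... | false = Ord-Q^ p

    wfSum-term : ∀ ω → wfSum l (term (suc ω))
      ≈ Πfrom pre 3 l * (v ^ suc ω * Π< (suc l) (λ i → geo (φ (suc ω) (suc (suc i)))) + κ ω)
    wfSum-term ω = begin
      wfSum l (term (suc ω))
        ≈⟨ wfSum-+ l _ _ ⟩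
      wfSum l (λ xs → v ^ suc ω * value (φ (suc ω)) 3 xs) + wfSum l (λ xs → κ ω * value (λ _ → 0#) 3 xs)
        ≈⟨ +-cong (wfSum-*ˡ l _ _) (wfSum-*ˡ l _ _) ⟩
      v ^ suc ω * wfSum l (value (φ (suc ω)) 3) + κ ω * wfSum l (value (λ _ → 0#) 3)
        ≈⟨ +-cong (*-congˡ (trans (wfSum-value (φ (suc ω)) (Ord-φ (suc ω)) l 2) (*-congˡ (evenProduct (suc ω)))))
                  (*-congˡ (trans (wfSum-value (λ _ → 0#) (λ _ → Ord-0) l 2) (*-congˡ (Πfrom-one (evenFactor (λ _ → 0#)) 3 l (λ i _ → evenFactor-0 i))))) ⟩
      v ^ suc ω * (P * G) + κ ω * (P * 1#)
        ≈⟨ solve 4 (λ a P G k → a :* (P :* G) :+ k :* (P :* con (+ 1)) := P :* (a :* G :+ k)) refl (v ^ suc ω) P G (κ ω) ⟩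
      P * (v ^ suc ω * G + κ ω) ∎
      where
      P G : Carrier
      P = Πfrom pre 3 l
      G = Π< (suc l) (λ i → geo (φ (suc ω) (suc (suc i))))
      evenFactor-0 : ∀ i → evenFactor (λ _ → 0#) i ≈ 1#
      evenFactor-0 i with isEven i
      ... | true  = geo-vanish refl
      ... | false = refl

    wfSum-terms : Σ< (suc n) (λ i → wfSum l (term i)) ≈ Πfrom pre 3 l * crankSeries
    wfSum-terms = begin
      Σ< (suc n) (λ i → wfSum l (term i))
        ≈⟨ Σ<-front n _ ⟩
      wfSum l (largestValue 0 3) + Σ< n (λ ω → wfSum l (term (suc ω)))
        ≈⟨ +-cong (trans (wfSum-largest l 2 0 z≤n) (*-congˡ largestSum-all)) (trans (Σ<-cong n (λ ω _ → wfSum-term ω)) (Σ<-*ˡ n P _)) ⟩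
      P * E + P * Σ< n (λ ω → W ω + κ ω)
        ≈⟨ +-congˡ (*-congˡ (trans (Σ<-front (suc l) _) (trans (+-congˡ (Σ<-cong (suc l) (λ _ _ → +-identityʳ _)))
             (solve 3 (λ a b s → a :+ b :+ s := b :+ (a :+ s)) refl _ _ _)))) ⟩
      P * E + P * ((zQ - Q) + (W 0 + Σ< (suc l) (W ∘ suc)))
        ≈⟨ +-congˡ (*-congˡ (+-congˡ (Σ<-front (suc l) W))) ⟨
      P * E + P * ((zQ - Q) + Σ< n W)
        ≈⟨ solve 4 (λ P E k s → P :* E :+ P :* (k :+ s) := P :* (E :+ k :+ s)) refl P E (zQ - Q) (Σ< n W) ⟩
      P * crankSeries ∎
      where
      P E : Carrier
      P = Πfrom pre 3 l
      E = largestPartSum 0 1 (suc l)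
      W : ℕ → Carrier
      W ω = v ^ suc ω * Π< (suc l) (λ i → geo (φ (suc ω) (suc (suc i))))

    wfSum-leaf : wfSum n leaf ≈ Πfrom pre 1 n * crankSeries
    wfSum-leaf = begin
      wfSum n leaf
        ≈⟨ wfSum-suc (suc l) leaf (q ^ 1) (λ i → q ^ i * T)
             (λ m → wfSum-*ˡ (suc l) _ _)
             (λ i → trans (wfSum-*ˡ (suc l) _ _) (trans (*-congʳ (^-homo-* q 1 i)) (*-assoc _ _ _)))
             (trans (sym (*-assoc _ _ _)) (trans (*-congʳ (Ord-vanish ℕ.≤-refl (Ord-* (Ord-q^ 0) (Ord-^ n Ord-q)))) (zeroˡ _))) ⟩
      (1# + q ^ 1) * Σ< (suc n) (λ i → q ^ i * T)
        ≈⟨ *-congˡ (trans (Σ<-cong (suc n) (λ i _ → trans (*-congʳ (^-congˡ i (sym (*-identityʳ q)))) (*-comm _ _))) (Σ<-*ˡ (suc n) T ((q ^ 1) ^_))) ⟩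
      (1# + q ^ 1) * (T * geo (q ^ 1))
        ≈⟨ *-congˡ (*-congʳ (trans inner (*-congˡ wfSum-terms))) ⟩
      (1# + q ^ 1) * ((1# + q ^ 2) * (Πfrom pre 3 l * crankSeries) * geo (q ^ 1))
        ≈⟨ solve 5 (λ a b P C g → a :* (b :* (P :* C) :* g) := a :* g :* (b :* P) :* C) refl (1# + q ^ 1) (1# + q ^ 2) (Πfrom pre 3 l) crankSeries (geo (q ^ 1)) ⟩
      (1# + q ^ 1) * geo (q ^ 1) * ((1# + q ^ 2) * Πfrom pre 3 l) * crankSeries ∎
      where
      T : Carrier
      T = wfSum (suc l) leafTail
      S : ℕ → Carrier
      S i = wfSum l (term i)
      -- For `n` ones the term carries vⁿ, and its `κ` summand is zero because n ≥ 2.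
      Ord-term : Ord n (S n)
      Ord-term = Ord-≈ (sym (trans (wfSum-cong l (λ xs → trans (+-congˡ (zeroˡ _)) (+-identityʳ _))) (wfSum-*ˡ l (v ^ n) (value (φ n) 3))))
        (Ord-*ʳ _ (Ord-^ n Ord-v))
      inner : T ≈ (1# + q ^ 2) * Σ< (suc n) S
      inner = wfSum-suc l leafTail (q ^ 2) S
        (λ m → trans (wfSum-*ˡ l _ _) (*-identityˡ _))
        (λ i → wfSum-*ˡ l _ _)
        (Ord-vanish (ℕ.n<1+n n) (Ord-weaken (ℕ.n≤1+n (suc n)) (Ord-* (Ord-q^ 1) Ord-term)))

    Pos-leaf : Pos (wfSum n leaf)
    Pos-leaf = Pos-≈ (sym (trans wfSum-leaf (*-congʳ preProduct))) Pos-overpartitionSeries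

-- The crank of the halved partition in terms of its ones.

count-replicate : ∀ p i j r → countᵇ p (replicate i j ++ r) ≡ (if p j then i else 0) ℕ.+ countᵇ p r
count-replicate p zero    j r with p j
... | true  = ≡.refl
... | false = ≡.refl
count-replicate p (suc i) j r with p j in eq
... | true  = ≡.cong suc (≡.trans (count-replicate p i j r) (≡.cong (λ b → (if b then i else 0) ℕ.+ countᵇ p r) eq))
... | false = ≡.trans (count-replicate p i j r) (≡.cong (λ b → (if b then i else 0) ℕ.+ countᵇ p r) eq)

isOne isEmpty : List ℕ → Bool
isOne (1 ∷ []) = true
isOne _        = false
isEmpty []      = true
isEmpty (_ ∷ _) = false

halvedIsOne-isOne : ∀ xs → halvedIsOne xs ≡ isOne (halved 1 xs)
halvedIsOne-isOne xs with halved 1 xs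
... | []                 = ≡.refl
... | zero ∷ _           = ≡.refl
... | 1 ∷ []             = ≡.refl
... | 1 ∷ _ ∷ _          = ≡.refl
... | suc (suc _) ∷ _    = ≡.refl

-- Even sizes from 4 on halve to at least 2, so every one comes from size 2.
halved-no-ones : ∀ k xs → countᵇ (ℕ._≡ᵇ 1) (halved (suc (suc (suc k))) xs) ≡ 0
halved-no-ones k []             = ≡.refl
halved-no-ones k ((m , b) ∷ xs) with isEven (suc k) in even
... | false = halved-no-ones (suc k) xs
halved-no-ones (suc k) ((m , b) ∷ xs) | true =
  ≡.trans (count-replicate (ℕ._≡ᵇ 1) (m ℕ.∸ bit b) (suc (suc ℕ.⌊ k /2⌋)) _) (halved-no-ones (suc (suc k)) xs)

partContribution : ℤ → List ℕ → ℤ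
partContribution m ps = if isOne ps then special m else (if does (crank ps ℤ.≟ m) then + 1 else + 0)

contribution-halved : ∀ m xs → contribution m xs ≡ partContribution m (halved 1 xs)
contribution-halved m xs = ≡.cong (λ b → if b then special m else (if does (secondResidualCrank xs ℤ.≟ m) then + 1 else + 0)) (halvedIsOne-isOne xs)

does-≡ : ∀ {p} {P : Set p} (d : Dec P) b → (P → b ≡ true) → (b ≡ true → P) → does d ≡ b
does-≡ (yes p) b     f g = ≡.sym (f p)
does-≡ (no ¬p) true  f g = contradiction (g ≡.refl) ¬p
does-≡ (no ¬p) false f g = ≡.refl

≡ᵇ-refl : ∀ a → (a ℕ.≡ᵇ a) ≡ true
≡ᵇ-refl zero    = ≡.refl
≡ᵇ-refl (suc a) = ≡ᵇ-refl a

≡ᵇ-sound : ∀ a b → (a ℕ.≡ᵇ b) ≡ true → a ≡ b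
≡ᵇ-sound zero    zero    _ = ≡.refl
≡ᵇ-sound (suc a) (suc b) e = ≡.cong suc (≡ᵇ-sound a b e)

≡ᵇ-complete : ∀ {a b} → a ≡ b → (a ℕ.≡ᵇ b) ≡ true
≡ᵇ-complete {a} ≡.refl = ≡ᵇ-refl a

≡ᵇ-cancelˡ : ∀ c a b → (c ℕ.+ a ℕ.≡ᵇ c ℕ.+ b) ≡ (a ℕ.≡ᵇ b)
≡ᵇ-cancelˡ zero    a b = ≡.refl
≡ᵇ-cancelˡ (suc c) a b = ≡ᵇ-cancelˡ c a b

indicator : Bool → ℤ
indicator b = if b then + 1 else + 0

isOne-ones : ∀ r → countᵇ (ℕ._≡ᵇ 1) r ≡ 0 → isOne r ≡ false
isOne-ones []                _ = ≡.refl
isOne-ones (zero ∷ _)        _ = ≡.refl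
isOne-ones (suc (suc _) ∷ _) _ = ≡.refl

partContribution-no-ones : ∀ k r → countᵇ (ℕ._≡ᵇ 1) r ≡ 0 →
  partContribution (+ k) r ≡ indicator (largest r ℕ.≡ᵇ k)
partContribution-no-ones k r none rewrite isOne-ones r none | none =
  ≡.cong indicator (does-≡ (+ largest r ℤ.≟ + k) _
    (λ e → ≡ᵇ-complete (ℤ.+-injective e)) (λ e → ≡.cong +_ (≡ᵇ-sound _ k e)))

crank-ones : ∀ ω r → countᵇ (ℕ._≡ᵇ 1) r ≡ 0 →
  crank (replicate (suc ω) 1 ++ r) ≡ + countᵇ (suc ω ℕ.<ᵇ_) r ℤ.- + suc ω
crank-ones ω r none
  rewrite count-replicate (ℕ._≡ᵇ 1) ω 1 r | none | ℕ.+-identityʳ ω | count-replicate (suc ω ℕ.<ᵇ_) ω 1 r = ≡.refl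

special-indicator : ∀ k → special (+ k) ≡ indicator (1 ℕ.≡ᵇ k) ℤ.- indicator (0 ℕ.≡ᵇ k)
special-indicator zero          = ≡.refl
special-indicator (suc zero)    = ≡.refl
special-indicator (suc (suc k)) = ≡.refl

wellFormed-∷ : ∀ m b xs → wellFormed ((m , b) ∷ xs) ≡ true → bit b ℕ.+ (m ℕ.∸ bit b) ≡ m × wellFormed xs ≡ true
wellFormed-∷ m       false xs e = ≡.refl , e
wellFormed-∷ (suc m) true  xs e = ≡.refl , e

if-same : ∀ b → (if b then + 0 else + 0) ≡ + 0
if-same true  = ≡.refl
if-same false = ≡.refl

-- At zero, the coefficient of zᵏ in z - 1, matching `κ`; the remaining +1 at crank -1 is the true
-- crank of the single part 1.
correction : ℕ → ℕ → ℤ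
correction k zero    = indicator (1 ℕ.≡ᵇ k) ℤ.- indicator (0 ℕ.≡ᵇ k)
correction k (suc _) = + 0

crank-does : ∀ C ω k → does (+ C ℤ.- + ω ℤ.≟ + k) ≡ (C ℕ.≡ᵇ ω ℕ.+ k)
crank-does C ω k = does-≡ (+ C ℤ.- + ω ℤ.≟ + k) _ (λ e → ≡ᵇ-complete (to e)) (λ e → from (≡ᵇ-sound C (ω ℕ.+ k) e))
  where
  to : + C ℤ.- + ω ≡ + k → C ≡ ω ℕ.+ k
  to e = ≡.trans (ℤ.+-injective (≡.trans (≡.sym (cancel (+ C) (+ ω))) (≡.cong (ℤ._+ + ω) e))) (ℕ.+-comm k ω)
    where
    cancel : ∀ a b → a ℤ.- b ℤ.+ b ≡ a
    cancel a b = ≡.trans (ℤ.+-assoc a (ℤ.- b) b) (≡.trans (≡.cong (λ t → a ℤ.+ t) (ℤ.+-inverseˡ b)) (ℤ.+-identityʳ a))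
  from : C ≡ ω ℕ.+ k → + C ℤ.- + ω ≡ + k
  from ≡.refl = ≡.trans (≡.cong (ℤ._- + ω) (ℤ.+-comm (+ ω) (+ k)))
    (≡.trans (ℤ.+-assoc (+ k) (+ ω) (ℤ.- + ω)) (≡.trans (≡.cong (λ t → + k ℤ.+ t) (ℤ.+-inverseʳ (+ ω))) (ℤ.+-identityʳ (+ k))))

-- For the single part 1 the indicator is zero, since its crank -1 is never k ≥ 0, and `special` is
-- all correction. In every other case the correction is zero and the crank decides.
partContribution-ones : ∀ k ω r → countᵇ (ℕ._≡ᵇ 1) r ≡ 0 →
  partContribution (+ k) (replicate (suc ω) 1 ++ r)
    ≡ indicator (countᵇ (suc ω ℕ.<ᵇ_) r ℕ.≡ᵇ suc ω ℕ.+ k) ℤ.+ (if isEmpty r then correction k ω else + 0)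
partContribution-ones k zero    []      none = ≡.trans (special-indicator k) (≡.sym (ℤ.+-identityˡ _))
partContribution-ones k zero    (x ∷ r) none = ≡.trans
  (≡.cong indicator (≡.trans (≡.cong (λ c → does (c ℤ.≟ + k)) (crank-ones 0 (x ∷ r) none)) (crank-does (countᵇ (1 ℕ.<ᵇ_) (x ∷ r)) 1 k)))
  (≡.sym (ℤ.+-identityʳ _))
partContribution-ones k (suc ω) r       none = ≡.trans
  (≡.cong indicator (≡.trans (≡.cong (λ c → does (c ℤ.≟ + k)) (crank-ones (suc ω) r none)) (crank-does (countᵇ (suc (suc ω) ℕ.<ᵇ_) r) (suc (suc ω)) k)))
  (≡.sym (≡.trans (≡.cong (λ t → indicator (countᵇ (suc (suc ω) ℕ.<ᵇ_) r ℕ.≡ᵇ suc (suc ω) ℕ.+ k) ℤ.+ t) (if-same (isEmpty r))) (ℤ.+-identityʳ _)))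

indicator-<ᵇ-suc : ∀ d D → indicator (d ℕ.<ᵇ D) ℤ.+ indicator (D ℕ.≡ᵇ d) ≡ indicator (d ℕ.<ᵇ suc D)
indicator-<ᵇ-suc zero    zero    = ≡.refl
indicator-<ᵇ-suc zero    (suc D) = ≡.refl
indicator-<ᵇ-suc (suc d) zero    = ≡.refl
indicator-<ᵇ-suc (suc d) (suc D) = indicator-<ᵇ-suc d D

indicator-<ᵇ-antitone : ∀ b k D → indicator (b ℕ.+ suc k ℕ.<ᵇ D) ℤ.≤ indicator (b ℕ.+ k ℕ.<ᵇ D)
indicator-<ᵇ-antitone (suc b) k zero    = ℤ.≤-refl
indicator-<ᵇ-antitone (suc b) k (suc D) = indicator-<ᵇ-antitone b k D
indicator-<ᵇ-antitone zero    k zero    = ℤ.≤-refl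
indicator-<ᵇ-antitone zero zero    (suc zero)    = ℤ.+≤+ z≤n
indicator-<ᵇ-antitone zero zero    (suc (suc D)) = ℤ.≤-refl
indicator-<ᵇ-antitone zero (suc k) (suc D)       = indicator-<ᵇ-antitone zero k D

-- Reading off the coefficients of qⁿzᵏ.

module Extraction {c ℓ : Level} (R : CommutativeRing c ℓ) where

  open CommutativeRing R hiding (zero)
  open import Algebra.Properties.CommutativeSemiring.Exp commutativeSemiring
  open import Relation.Binary.Reasoning.Setoid setoid
  open IntegerCoefficients R using (solve; _:=_; _:+_; _:*_; _:-_; con)
  open QSeries R
  open Enumeration R

  module Monomials (z y : Carrier) (l : ℕ) (y-nilpotent : y ^ suc (suc (suc l)) ≈ 0#) where

    open Truncated z y (suc l) y-nilpotent
    open Counting z y l y-nilpotent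

    φ-monomial : ∀ ω j → φ ω j ≈ z ^ (if ω ℕ.<ᵇ j then 1 else 0) * Q ^ j
    φ-monomial ω j with ω ℕ.<ᵇ j
    ... | true  = *-congʳ (sym (*-identityʳ z))
    ... | false = sym (*-identityˡ _)

    if-* : ∀ b i → (if b then 1 else 0) ℕ.* i ≡ (if b then i else 0)
    if-* true  i = ℕ.+-identityʳ i
    if-* false i = ≡.refl

    q^-bit : ∀ b k → (if b then q ^ k else 1#) ≈ (q ^ k) ^ bit b
    q^-bit true  k = sym (*-identityʳ _)
    q^-bit false k = refl

    value-monomial : ∀ ω k xs → wellFormed xs ≡ true →
      value (φ ω) k xs ≈ q ^ weight k xs * z ^ countᵇ (ω ℕ.<ᵇ_) (halved k xs)
    value-monomial ω k []             wf = sym (*-identityˡ _)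
    value-monomial ω k ((m , b) ∷ xs) wf with wellFormed-∷ m b xs wf | isEven k in even
    ... | m≡ , wf′ | false = begin
      q ^ (k ℕ.* m) * value (φ ω) (suc k) xs                       ≈⟨ *-congˡ (value-monomial ω (suc k) xs wf′) ⟩
      q ^ (k ℕ.* m) * (q ^ weight (suc k) xs * z ^ countᵇ (ω ℕ.<ᵇ_) (halved (suc k) xs))  ≈⟨ *-assoc _ _ _ ⟨
      q ^ (k ℕ.* m) * q ^ weight (suc k) xs * z ^ countᵇ (ω ℕ.<ᵇ_) (halved (suc k) xs)    ≈⟨ *-congʳ (^-homo-* q (k ℕ.* m) _) ⟨
      q ^ (k ℕ.* m ℕ.+ weight (suc k) xs) * z ^ countᵇ (ω ℕ.<ᵇ_) (halved (suc k) xs)      ∎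
    ... | m≡ , wf′ | true = begin
      (if b then q ^ k else 1#) * φ ω j ^ i * value (φ ω) (suc k) xs
        ≈⟨ *-cong (*-cong (q^-bit b k) φ^) (value-monomial ω (suc k) xs wf′) ⟩
      (q ^ k) ^ bit b * (Z * (q ^ k) ^ i) * (q ^ weight (suc k) xs * z ^ C)
        ≈⟨ solve 5 (λ a Z b w c → a :* (Z :* b) :* (w :* c) := (a :* b) :* w :* (Z :* c)) refl ((q ^ k) ^ bit b) Z ((q ^ k) ^ i) (q ^ weight (suc k) xs) (z ^ C) ⟩
      ((q ^ k) ^ bit b * (q ^ k) ^ i) * q ^ weight (suc k) xs * (Z * z ^ C)
        ≈⟨ *-cong (*-congʳ (trans (sym (^-homo-* (q ^ k) (bit b) i)) (trans (^-congʳ (q ^ k) m≡) (^-assocʳ q k m))))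
                  (sym (^-homo-* z (if ω ℕ.<ᵇ j then i else 0) C)) ⟩
      q ^ (k ℕ.* m) * q ^ weight (suc k) xs * z ^ ((if ω ℕ.<ᵇ j then i else 0) ℕ.+ C)
        ≈⟨ *-cong (^-homo-* q (k ℕ.* m) _) (^-congʳ z (count-replicate (ω ℕ.<ᵇ_) i j (halved (suc k) xs))) ⟨
      q ^ (k ℕ.* m ℕ.+ weight (suc k) xs) * z ^ countᵇ (ω ℕ.<ᵇ_) (replicate i j ++ halved (suc k) xs) ∎
      where
      i j C : ℕ
      i = m ℕ.∸ bit b
      j = ℕ.⌊ k /2⌋
      C = countᵇ (ω ℕ.<ᵇ_) (halved (suc k) xs)
      Z : Carrier
      Z = z ^ (if ω ℕ.<ᵇ j then i else 0)
      φ^ : φ ω j ^ i ≈ Z * (q ^ k) ^ i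
      φ^ = begin
        φ ω j ^ i                                                 ≈⟨ ^-congˡ i (φ-monomial ω j) ⟩
        (z ^ (if ω ℕ.<ᵇ j then 1 else 0) * Q ^ j) ^ i             ≈⟨ ^-distrib-* _ _ i ⟩
        (z ^ (if ω ℕ.<ᵇ j then 1 else 0)) ^ i * (Q ^ j) ^ i
          ≈⟨ *-cong (trans (^-assocʳ z (if ω ℕ.<ᵇ j then 1 else 0) i) (^-congʳ z (if-* (ω ℕ.<ᵇ j) i)))
                    (^-congˡ i (trans (sym (q^double j)) (^-congʳ q (double-⌊/2⌋ k even)))) ⟩
        Z * (q ^ k) ^ i                                           ∎

    -- As 0⁰ = 1, the weight 0 on non-overlined even parts selects the codes that have none.
    value-0 : ∀ k xs → wellFormed xs ≡ true →
      value (λ _ → 0#) k xs ≈ (if isEmpty (halved k xs) then q ^ weight k xs else 0#)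
    value-0 k []             wf = refl
    value-0 k ((m , b) ∷ xs) wf with wellFormed-∷ m b xs wf | isEven k in even
    ... | m≡ , wf′ | false = trans (*-congˡ (value-0 (suc k) xs wf′)) (absorb (isEmpty (halved (suc k) xs)))
      where
      absorb : ∀ e → q ^ (k ℕ.* m) * (if e then q ^ weight (suc k) xs else 0#)
        ≈ (if e then q ^ (k ℕ.* m ℕ.+ weight (suc k) xs) else 0#)
      absorb true  = sym (^-homo-* q (k ℕ.* m) _)
      absorb false = zeroʳ _
    ... | m≡ , wf′ | true with m ℕ.∸ bit b
    ...   | suc i = trans (*-congʳ (trans (*-congˡ (zeroˡ _)) (zeroʳ _))) (zeroˡ _)
    ...   | zero  = trans (*-cong (trans (*-identityʳ _) (trans (q^-bit b k) (^-congʳ (q ^ k) (≡.trans (≡.sym (ℕ.+-identityʳ (bit b))) m≡)))) (value-0 (suc k) xs wf′))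
                          (absorb (isEmpty (halved (suc k) xs)))
      where
      absorb : ∀ e → (q ^ k) ^ m * (if e then q ^ weight (suc k) xs else 0#)
        ≈ (if e then q ^ (k ℕ.* m ℕ.+ weight (suc k) xs) else 0#)
      absorb true  = trans (*-congʳ (^-assocʳ q k m)) (sym (^-homo-* q (k ℕ.* m) _))
      absorb false = zeroʳ _

    -- Passes from q and z to the independent variables y and z, in which monomials can be told
    -- apart.
    q^*z^ : ∀ a b → q ^ a * z ^ b ≈ y ^ a * z ^ (a ℕ.+ b)
    q^*z^ a b = begin
      q ^ a * z ^ b              ≈⟨ *-congʳ (^-distrib-* z y a) ⟩
      z ^ a * y ^ a * z ^ b      ≈⟨ solve 3 (λ u v w → u :* v :* w := v :* (u :* w)) refl (z ^ a) (y ^ a) (z ^ b) ⟩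
      y ^ a * (z ^ a * z ^ b)    ≈⟨ *-congˡ (^-homo-* z a b) ⟨
      y ^ a * z ^ (a ℕ.+ b)      ∎

    -- The weight of a code without its non-overlined 2's: `m` parts 1, `e` overlined parts 2, and
    -- `w` from the larger sizes.
    weight′ : ℕ → ℕ → ℕ → ℕ
    weight′ m e w = m ℕ.+ (2 ℕ.* e ℕ.+ w)

    q^-weight′ : ∀ m b w x → q ^ m * ((if b then q ^ 2 else 1#) * (q ^ w * x)) ≈ q ^ weight′ m (bit b) w * x
    q^-weight′ m b w x = begin
      q ^ m * ((if b then q ^ 2 else 1#) * (q ^ w * x))
        ≈⟨ *-congˡ (*-congʳ (trans (q^-bit b 2) (^-assocʳ q 2 (bit b)))) ⟩
      q ^ m * (q ^ (2 ℕ.* bit b) * (q ^ w * x))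
        ≈⟨ solve 4 (λ a b c x → a :* (b :* (c :* x)) := a :* (b :* c) :* x) refl (q ^ m) (q ^ (2 ℕ.* bit b)) (q ^ w) x ⟩
      q ^ m * (q ^ (2 ℕ.* bit b) * q ^ w) * x
        ≈⟨ *-congʳ (trans (^-homo-* q m _) (*-congˡ (^-homo-* q (2 ℕ.* bit b) w))) ⟨
      q ^ weight′ m (bit b) w * x ∎

    -- Characterises the coefficient of qⁿzᵏ, that is of yⁿzⁿ⁺ᵏ, by additivity and its values on
    -- monomials, leaving the concrete ring open.
    record IsCoefficient (k : ℕ) (coef : Carrier → ℤ) : Set (c ⊔ ℓ) where
      field
        coef-cong : ∀ {f f′} → f ≈ f′ → coef f ≡ coef f′
        coef-+    : ∀ f f′ → coef (f + f′) ≡ coef f ℤ.+ coef f′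
        coef-neg  : ∀ f → coef (- f) ≡ ℤ.- coef f
        coef-0    : coef 0# ≡ + 0
        coef-mono : ∀ i j → coef (y ^ i * z ^ j) ≡ (if i ℕ.≡ᵇ n then indicator (j ℕ.≡ᵇ n ℕ.+ k) else + 0)

      coef-q : ∀ a b → coef (q ^ a * z ^ b) ≡ (if a ℕ.≡ᵇ n then indicator (b ℕ.≡ᵇ k) else + 0)
      coef-q a b = ≡.trans (coef-cong (q^*z^ a b)) (≡.trans (coef-mono a (a ℕ.+ b)) shift)
        where
        shift : (if a ℕ.≡ᵇ n then indicator (a ℕ.+ b ℕ.≡ᵇ n ℕ.+ k) else + 0) ≡ (if a ℕ.≡ᵇ n then indicator (b ℕ.≡ᵇ k) else + 0)
        shift with a ℕ.≡ᵇ n in eq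
        ... | false = ≡.refl
        ... | true  with ≡.refl ← ≡ᵇ-sound a n eq = ≡.cong indicator (≡ᵇ-cancelˡ n b k)

      -- The monomial is q^(a+2ω) z^(b-ω), so the exponent of z is k exactly when b = ω + k.
      coef-vq : ∀ a ω b → coef (v ^ ω * (q ^ a * z ^ b)) ≡ (if a ℕ.+ (ω ℕ.+ ω) ℕ.≡ᵇ n then indicator (b ℕ.≡ᵇ ω ℕ.+ k) else + 0)
      coef-vq a ω b = ≡.trans (coef-cong monomial) (≡.trans (coef-mono (a ℕ.+ (ω ℕ.+ ω)) (a ℕ.+ ω ℕ.+ b)) shift)
        where
        monomial : v ^ ω * (q ^ a * z ^ b) ≈ y ^ (a ℕ.+ (ω ℕ.+ ω)) * z ^ (a ℕ.+ ω ℕ.+ b)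
        monomial = begin
          v ^ ω * (q ^ a * z ^ b)             ≈⟨ *-congʳ (^-distrib-* q y ω) ⟩
          q ^ ω * y ^ ω * (q ^ a * z ^ b)     ≈⟨ solve 4 (λ s t u w → s :* t :* (u :* w) := t :* (u :* s :* w)) refl (q ^ ω) (y ^ ω) (q ^ a) (z ^ b) ⟩
          y ^ ω * (q ^ a * q ^ ω * z ^ b)     ≈⟨ *-congˡ (*-congʳ (^-homo-* q a ω)) ⟨
          y ^ ω * (q ^ (a ℕ.+ ω) * z ^ b)     ≈⟨ *-congˡ (q^*z^ (a ℕ.+ ω) b) ⟩
          y ^ ω * (y ^ (a ℕ.+ ω) * z ^ (a ℕ.+ ω ℕ.+ b))  ≈⟨ *-assoc _ _ _ ⟨
          y ^ ω * y ^ (a ℕ.+ ω) * z ^ (a ℕ.+ ω ℕ.+ b)    ≈⟨ *-congʳ (^-homo-* y ω (a ℕ.+ ω)) ⟨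
          y ^ (ω ℕ.+ (a ℕ.+ ω)) * z ^ (a ℕ.+ ω ℕ.+ b)
            ≈⟨ *-congʳ (^-congʳ y (≡.trans (ℕ.+-comm ω (a ℕ.+ ω)) (ℕ.+-assoc a ω ω))) ⟩
          y ^ (a ℕ.+ (ω ℕ.+ ω)) * z ^ (a ℕ.+ ω ℕ.+ b)    ∎
        shift : (if a ℕ.+ (ω ℕ.+ ω) ℕ.≡ᵇ n then indicator (a ℕ.+ ω ℕ.+ b ℕ.≡ᵇ n ℕ.+ k) else + 0)
          ≡ (if a ℕ.+ (ω ℕ.+ ω) ℕ.≡ᵇ n then indicator (b ℕ.≡ᵇ ω ℕ.+ k) else + 0)
        shift with a ℕ.+ (ω ℕ.+ ω) ℕ.≡ᵇ n in eq
        ... | false = ≡.refl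
        ... | true  = ≡.cong indicator (≡.trans
          (≡.cong (a ℕ.+ ω ℕ.+ b ℕ.≡ᵇ_) (≡.trans (≡.cong (ℕ._+ k) (≡.trans (≡.sym (≡ᵇ-sound _ n eq)) (≡.sym (ℕ.+-assoc a ω ω)))) (ℕ.+-assoc (a ℕ.+ ω) ω k)))
          (≡ᵇ-cancelˡ (a ℕ.+ ω) b (ω ℕ.+ k)))

      coef-κ : ∀ ω a → coef (κ ω * q ^ a) ≡ (if a ℕ.+ (suc ω ℕ.+ suc ω) ℕ.≡ᵇ n then correction k ω else + 0)
      coef-κ (suc ω) a = ≡.trans (coef-cong (zeroˡ _)) (≡.trans coef-0 (≡.sym (if-same (a ℕ.+ (suc (suc ω) ℕ.+ suc (suc ω)) ℕ.≡ᵇ n))))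
      coef-κ zero a = ≡.trans (coef-cong split) (≡.trans (coef-+ _ _) (≡.trans
        (≡.cong₂ ℤ._+_ (coef-q (a ℕ.+ 2) 1) (≡.trans (coef-neg _) (≡.cong ℤ.-_ (coef-q (a ℕ.+ 2) 0))))
        (combine (a ℕ.+ 2 ℕ.≡ᵇ n))))
        where
        split : (zQ - Q) * q ^ a ≈ q ^ (a ℕ.+ 2) * z ^ 1 - q ^ (a ℕ.+ 2) * z ^ 0
        split = trans
          (solve 3 (λ z q t → (z :* (q :* q) :- q :* q) :* t
            := t :* (q :* (q :* con (+ 1))) :* (z :* con (+ 1)) :- t :* (q :* (q :* con (+ 1))) :* con (+ 1)) refl z q (q ^ a))
          (sym (+-cong (*-congʳ (^-homo-* q a 2)) (-‿cong (*-congʳ (^-homo-* q a 2)))))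
        combine : ∀ b → (if b then indicator (1 ℕ.≡ᵇ k) else + 0) ℤ.- (if b then indicator (0 ℕ.≡ᵇ k) else + 0)
          ≡ (if b then correction k 0 else + 0)
        combine true  = ≡.refl
        combine false = ≡.refl

      -- Split by the number of non-overlined 2's: with none, the exponent of z is the largest
      -- halved part; with ω + 1 of them, v^(ω+1) lowers the count of larger parts by ω + 1. Both
      -- exponents are the crank.
      leafCoefficient : ∀ xs → wellFormed xs ≡ true →
        coef (leaf xs) ≡ (if weight 1 xs ℕ.≡ᵇ n then contribution (+ k) xs else + 0)
      leafCoefficient [] wf = coef-0
      leafCoefficient ((m , b) ∷ []) wf = ≡.trans (coef-q m 0)
        (≡.cong₂ (λ w₃ t → if w₃ ℕ.≡ᵇ n then t else + 0)
          (≡.sym (≡.trans (ℕ.+-identityʳ (m ℕ.+ 0)) (ℕ.+-identityʳ m)))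
          (≡.sym (≡.trans (contribution-halved (+ k) ((m , b) ∷ [])) (partContribution-no-ones k [] ≡.refl))))
      leafCoefficient xs@((m , b₁) ∷ (m₂ , b) ∷ rest) wf
        with wellFormed-∷ m b₁ ((m₂ , b) ∷ rest) wf
      ... | _ , wf₂ with wellFormed-∷ m₂ b rest wf₂
      ... | m₂≡ , wf₃ = ≡.trans (byOnes (m₂ ℕ.∸ bit b) m₂≡) (≡.cong (λ t → if weight 1 xs ℕ.≡ᵇ n then t else + 0) (≡.sym (contribution-halved (+ k) xs)))
        where
        w₃ e : ℕ
        w₃ = weight 3 rest
        e = bit b
        r : List ℕ
        r = halved 3 rest
        none : countᵇ (ℕ._≡ᵇ 1) r ≡ 0
        none = halved-no-ones 0 rest
        B : Carrier
        B = if b then q ^ 2 else 1#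
        weight≡ : ∀ ω → e ℕ.+ ω ≡ m₂ → weight 1 xs ≡ weight′ m e w₃ ℕ.+ (ω ℕ.+ ω)
        weight≡ ω ≡.refl = ℕ-solve 4 (λ m e w₃ ω → m ⊕ ℕcon 0 ⊕ ((e ⊕ ω) ⊕ ((e ⊕ ω) ⊕ ℕcon 0) ⊕ w₃)
          ⊜ m ⊕ ((e ⊕ (e ⊕ ℕcon 0)) ⊕ w₃) ⊕ (ω ⊕ ω)) ≡.refl m e w₃ ω
        byOnes : ∀ ω → e ℕ.+ ω ≡ m₂ →
          coef (q ^ m * (B * term ω rest)) ≡ (if weight 1 xs ℕ.≡ᵇ n then partContribution (+ k) (replicate ω 1 ++ r) else + 0)
        byOnes zero m₂≡ = ≡.trans (coef-cong (q^-weight′ m b w₃ _)) (≡.trans (coef-q (weight′ m e w₃) (largest r))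
          (≡.cong₂ (λ W t → if W ℕ.≡ᵇ n then t else + 0)
            (≡.sym (≡.trans (weight≡ 0 m₂≡) (ℕ.+-identityʳ _)))
            (≡.sym (partContribution-no-ones k r none))))
        byOnes (suc ω) m₂≡ = ≡.trans (coef-cong expand) (≡.trans (coef-+ _ _) (≡.trans
          (≡.cong₂ ℤ._+_ (coef-vq A (suc ω) C) (correct (isEmpty r)))
          (≡.trans (combine (A ℕ.+ (suc ω ℕ.+ suc ω) ℕ.≡ᵇ n))
            (≡.cong₂ (λ W t → if W ℕ.≡ᵇ n then t else + 0) (≡.sym (weight≡ (suc ω) m₂≡)) (≡.sym (partContribution-ones k ω r none))))))
          where
          A C : ℕ
          A = weight′ m e w₃
          C = countᵇ (suc ω ℕ.<ᵇ_) r
          K : Carrier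
          K = if isEmpty r then q ^ w₃ else 0#
          expand : q ^ m * (B * (v ^ suc ω * value (φ (suc ω)) 3 rest + κ ω * value (λ _ → 0#) 3 rest))
            ≈ v ^ suc ω * (q ^ A * z ^ C) + κ ω * (q ^ m * (B * K))
          expand = begin
            q ^ m * (B * (v ^ suc ω * value (φ (suc ω)) 3 rest + κ ω * value (λ _ → 0#) 3 rest))
              ≈⟨ *-congˡ (*-congˡ (+-cong (*-congˡ (value-monomial (suc ω) 3 rest wf₃)) (*-congˡ (value-0 3 rest wf₃)))) ⟩
            q ^ m * (B * (v ^ suc ω * (q ^ w₃ * z ^ C) + κ ω * K))
              ≈⟨ solve 6 (λ a b v x k y → a :* (b :* (v :* x :+ k :* y)) := v :* (a :* (b :* x)) :+ k :* (a :* (b :* y)))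
                   refl (q ^ m) B (v ^ suc ω) (q ^ w₃ * z ^ C) (κ ω) K ⟩
            v ^ suc ω * (q ^ m * (B * (q ^ w₃ * z ^ C))) + κ ω * (q ^ m * (B * K))
              ≈⟨ +-congʳ (*-congˡ (q^-weight′ m b w₃ (z ^ C))) ⟩
            v ^ suc ω * (q ^ A * z ^ C) + κ ω * (q ^ m * (B * K)) ∎
          correct : ∀ em → coef (κ ω * (q ^ m * (B * (if em then q ^ w₃ else 0#))))
            ≡ (if A ℕ.+ (suc ω ℕ.+ suc ω) ℕ.≡ᵇ n then (if em then correction k ω else + 0) else + 0)
          correct true  = ≡.trans (coef-cong (*-congˡ (trans (*-congˡ (*-congˡ (sym (*-identityʳ _)))) (trans (q^-weight′ m b w₃ 1#) (*-identityʳ _))))) (coef-κ ω A)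
          correct false = ≡.trans (coef-cong (trans (*-congˡ (trans (*-congˡ (zeroʳ B)) (zeroʳ _))) (zeroʳ _)))
            (≡.trans coef-0 (≡.sym (if-same (A ℕ.+ (suc ω ℕ.+ suc ω) ℕ.≡ᵇ n))))
          combine : ∀ b {s t} → (if b then s else + 0) ℤ.+ (if b then t else + 0) ≡ (if b then s ℤ.+ t else + 0)
          combine true  = ≡.refl
          combine false = ≡.refl

      coef-wfSum : coef (wfSum n leaf) ≡ M2 (+ k) n
      coef-wfSum = go (codes n n)
        where
        add : List OPData → ℤ
        add = foldr (λ xs acc → contribution (+ k) xs ℤ.+ acc) (+ 0)
        go : ∀ xss → coef (ΣL xss (λ xs → if wellFormed xs then leaf xs else 0#))
          ≡ add (filterᵇ (λ xs → (weight 1 xs ℕ.≡ᵇ n) ∧ wellFormed xs) xss)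
        go []         = coef-0
        go (xs ∷ xss) = ≡.trans (coef-+ _ _) (≡.trans (≡.cong (λ t → coef (if wellFormed xs then leaf xs else 0#) ℤ.+ t) (go xss)) here)
          where
          rest : ℤ
          rest = add (filterᵇ (λ xs → (weight 1 xs ℕ.≡ᵇ n) ∧ wellFormed xs) xss)
          here : coef (if wellFormed xs then leaf xs else 0#) ℤ.+ rest
            ≡ add (filterᵇ (λ xs → (weight 1 xs ℕ.≡ᵇ n) ∧ wellFormed xs) (xs ∷ xss))
          here with wellFormed xs in wf | weight 1 xs ℕ.≡ᵇ n in wt
          ... | true  | true  = ≡.cong (ℤ._+ rest) (≡.trans (leafCoefficient xs wf) (≡.cong (λ b → if b then contribution (+ k) xs else + 0) wt))
          ... | true  | false = ≡.trans (≡.cong (ℤ._+ rest) (≡.trans (leafCoefficient xs wf) (≡.cong (λ b → if b then contribution (+ k) xs else + 0) wt))) (ℤ.+-identityˡ rest)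
          ... | false | true  = ≡.trans (≡.cong (ℤ._+ rest) coef-0) (ℤ.+-identityˡ rest)
          ... | false | false = ≡.trans (≡.cong (ℤ._+ rest) coef-0) (ℤ.+-identityˡ rest)

      -- The monomial qᵃ yᵇ zᵗ is q^(a+b) z^(t-b), and t runs through 0, ..., 2s; hence the
      -- condition b + k ≤ 2s. At b = s this is k ≤ s, but `s` varies alone in the induction.
      coef-σ : ∀ a b s → coef (q ^ a * (y ^ b * σ s)) ≡ (if a ℕ.+ b ℕ.≡ᵇ n then indicator (b ℕ.+ k ℕ.<ᵇ suc (double s)) else + 0)
      coef-σ a b s = ≡.trans (expand s) (shift (a ℕ.+ b ℕ.≡ᵇ n) ≡.refl s)
        where
        single : ℕ → ℤ
        single t = if a ℕ.+ b ℕ.≡ᵇ n then indicator (a ℕ.+ t ℕ.≡ᵇ n ℕ.+ k) else + 0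
        total : ℕ → ℤ
        total zero    = single 0
        total (suc s) = total s ℤ.+ single (suc (double s)) ℤ.+ single (suc (suc (double s)))
        w^ : ∀ s → w ^ s ≈ z ^ double s
        w^ zero    = refl
        w^ (suc s) = trans (*-assoc _ _ _) (*-congˡ (*-congˡ (w^ s)))
        monomial : ∀ t → q ^ a * (y ^ b * z ^ t) ≈ y ^ (a ℕ.+ b) * z ^ (a ℕ.+ t)
        monomial t = begin
          q ^ a * (y ^ b * z ^ t)                   ≈⟨ solve 3 (λ u v w → u :* (v :* w) := v :* (u :* w)) refl (q ^ a) (y ^ b) (z ^ t) ⟩
          y ^ b * (q ^ a * z ^ t)                   ≈⟨ *-congˡ (q^*z^ a t) ⟩
          y ^ b * (y ^ a * z ^ (a ℕ.+ t))           ≈⟨ *-assoc _ _ _ ⟨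
          y ^ b * y ^ a * z ^ (a ℕ.+ t)             ≈⟨ *-congʳ (trans (^-homo-* y a b) (*-comm _ _)) ⟨
          y ^ (a ℕ.+ b) * z ^ (a ℕ.+ t)             ∎
        coef-single : ∀ t → coef (q ^ a * (y ^ b * z ^ t)) ≡ single t
        coef-single t = ≡.trans (coef-cong (monomial t)) (coef-mono (a ℕ.+ b) (a ℕ.+ t))
        expand : ∀ s → coef (q ^ a * (y ^ b * σ s)) ≡ total s
        expand zero    = coef-single 0
        expand (suc s) = ≡.trans (coef-cong split) (≡.trans (coef-+ _ _) (≡.cong₂ ℤ._+_
          (≡.trans (coef-+ _ _) (≡.cong₂ ℤ._+_ (expand s) (coef-single (suc (double s))))) (coef-single (suc (suc (double s))))))
          where
          split : q ^ a * (y ^ b * (σ s + z * w ^ s * (1# + z)))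
            ≈ q ^ a * (y ^ b * σ s) + q ^ a * (y ^ b * z ^ suc (double s)) + q ^ a * (y ^ b * z ^ suc (suc (double s)))
          split = trans (*-congˡ (*-congˡ (+-congˡ (*-congʳ (*-congˡ (w^ s))))))
            (solve 5 (λ u v s z t → u :* (v :* (s :+ z :* t :* (con (+ 1) :+ z)))
              := u :* (v :* s) :+ u :* (v :* (z :* t)) :+ u :* (v :* (z :* (z :* t)))) refl (q ^ a) (y ^ b) (σ s) z (z ^ double s))
        single≡ : (a ℕ.+ b ℕ.≡ᵇ n) ≡ true → ∀ t → single t ≡ indicator (t ℕ.≡ᵇ b ℕ.+ k)
        single≡ eq t rewrite eq = ≡.cong indicator (≡.trans
          (≡.cong (a ℕ.+ t ℕ.≡ᵇ_) (≡.trans (≡.cong (ℕ._+ k) (≡.sym (≡ᵇ-sound _ n eq))) (ℕ.+-assoc a b k))) (≡ᵇ-cancelˡ a t (b ℕ.+ k)))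
        shift : ∀ c → (a ℕ.+ b ℕ.≡ᵇ n) ≡ c → ∀ s → total s ≡ (if c then indicator (b ℕ.+ k ℕ.<ᵇ suc (double s)) else + 0)
        shift false eq zero    rewrite eq = ≡.refl
        shift false eq (suc s) rewrite shift false eq s | eq = ≡.refl
        shift true eq zero = ≡.trans (single≡ eq 0) (≡.trans (≡.sym (ℤ.+-identityˡ _)) (indicator-<ᵇ-suc (b ℕ.+ k) 0))
        shift true eq (suc s) = ≡.trans
          (≡.cong₂ ℤ._+_ (≡.trans (≡.cong₂ ℤ._+_ (shift true eq s) (single≡ eq (suc (double s)))) (indicator-<ᵇ-suc (b ℕ.+ k) (suc (double s)))) (single≡ eq (suc (suc (double s)))))
          (indicator-<ᵇ-suc (b ℕ.+ k) (suc (suc (double s))))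

    open IsCoefficient

    -- On a generator the two coefficients are indicators of k + 1 ≤ b and k ≤ b at the same power
    -- of q; sums and ring equality preserve the inequality.
    Pos-decreasing : ∀ {k coef coef′} → IsCoefficient k coef → IsCoefficient (suc k) coef′ →
      ∀ {f} → Pos f → coef′ f ℤ.≤ coef f
    Pos-decreasing {k} {coef} {coef′} C C′ (generator a b) =
      ≡.subst₂ ℤ._≤_ (≡.sym (coef-σ C′ a b b)) (≡.sym (coef-σ C a b b)) (compare (a ℕ.+ b ℕ.≡ᵇ n))
      where
      compare : ∀ t → (if t then indicator (b ℕ.+ suc k ℕ.<ᵇ suc (double b)) else + 0)
        ℤ.≤ (if t then indicator (b ℕ.+ k ℕ.<ᵇ suc (double b)) else + 0)
      compare true  = indicator-<ᵇ-antitone b k (suc (double b))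
      compare false = ℤ.≤-refl
    Pos-decreasing C C′ Pos-0       = ≡.subst₂ ℤ._≤_ (≡.sym (coef-0 C′)) (≡.sym (coef-0 C)) ℤ.≤-refl
    Pos-decreasing C C′ (Pos-+ f h) = ≡.subst₂ ℤ._≤_ (≡.sym (coef-+ C′ _ _)) (≡.sym (coef-+ C _ _))
      (ℤ.+-mono-≤ (Pos-decreasing C C′ f) (Pos-decreasing C C′ h))
    Pos-decreasing C C′ (Pos-≈ e f) = ≡.subst₂ ℤ._≤_ (coef-cong C′ e) (coef-cong C e) (Pos-decreasing C C′ f)

    M2-decreasing : ∀ {k coef coef′} → IsCoefficient k coef → IsCoefficient (suc k) coef′ → M2 (+ suc k) n ℤ.≤ M2 (+ k) n
    M2-decreasing C C′ = ≡.subst₂ ℤ._≤_ (coef-wfSum C′) (coef-wfSum C) (Pos-decreasing C C′ Pos-leaf)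

open import Data.Integer using (ℤ; +_; _-_; _≤_)

-- The concrete ring: doubly truncated integer series in z and y.

module Bivariate (l k : ℕ) where
  n : ℕ
  n = suc (suc l)

  -- The largest exponent of z that is read is n + (k + 1), for the coefficient of qⁿzᵏ⁺¹.
  module Inner = PowerSeries ℤ.+-*-commutativeRing (n ℕ.+ suc k)
  module Outer = PowerSeries Inner.seriesRing n
  open CommutativeRing Outer.seriesRing using (Carrier; _≈_; _*_; *-congˡ)
  open Extraction Outer.seriesRing using (module Monomials)

  z y : Carrier
  z = Outer.constant Inner.X
  y = Outer.X

  open Monomials z y l Outer.X^-nilpotent

  coefficient : ℕ → Carrier → ℤ
  coefficient j f = f n (n ℕ.+ j)

  isCoefficient : ∀ j → j ℕ.≤ suc k → IsCoefficient j (coefficient j)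
  isCoefficient j j≤k = record
    { coef-cong = λ e → e n ℕ.≤-refl (n ℕ.+ j) in-range
    ; coef-+    = λ _ _ → ≡.refl
    ; coef-neg  = λ _ → ≡.refl
    ; coef-0    = ≡.refl
    ; coef-mono = λ a b → ≡.trans (*-congˡ {x = Outer.X Outer.^ a} (Outer.constant-^ Inner.X b) n ℕ.≤-refl (n ℕ.+ j) in-range)
        (≡.trans (Outer.X^*ₛconstant a (Inner.X Inner.^ b) n (n ℕ.+ j) in-range) (select (a ℕ.≡ᵇ n) b))
    }
    where
    in-range : n ℕ.+ j ℕ.≤ n ℕ.+ suc k
    in-range = ℕ.+-monoʳ-≤ n j≤k
    select : ∀ t b → (if t then Inner.X Inner.^ b else Inner.0ₛ) (n ℕ.+ j)
      ≡ (if t then indicator (b ℕ.≡ᵇ n ℕ.+ j) else + 0)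
    select true  b = Inner.X^-coefficient b (n ℕ.+ j)
    select false b = ≡.refl

  M2-step : M2 (+ suc k) n ≤ M2 (+ k) n
  M2-step = M2-decreasing (isCoefficient k (ℕ.n≤1+n k)) (isCoefficient (suc k) ℕ.≤-refl)

theorem1p5 : (m : ℤ) (n : ℕ) → + 1 ≤ m → M2 m n ≤ M2 (m - + 1) n
-- The enumeration treats sizes 1 and 2 separately and so supposes n ≥ 2. For n ≤ 1 every halved
-- partition is empty with crank 0, and both sides evaluate.
theorem1p5 (+ suc zero)    zero          _ = ℤ.+≤+ z≤n
theorem1p5 (+ suc (suc k)) zero          _ = ℤ.≤-refl
theorem1p5 (+ suc zero)    (suc zero)    _ = ℤ.+≤+ z≤n
theorem1p5 (+ suc (suc k)) (suc zero)    _ = ℤ.≤-refl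
theorem1p5 (+ suc k)       (suc (suc l)) _ = Bivariate.M2-step l k
theorem1p5 (+ zero)        n (ℤ.+≤+ ())
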